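{- Let $G$ be a 2-ball, whose boundary is a cyclic graph of length $L$. There exists a finite sequence of edge refinements, each performed at an interior edge, which transforms $G$ into a graph in which every vertex has even degree, if and only if $L$ is divisible by $3$.
   Context: All graphs are finite simple graphs; $S(x)$ denotes the unit sphere of a vertex $x$, the subgraph induced by the neighbors of $x$. A graph is contractible if it is the one-vertex graph $K_1$, or if it has a vertex $x$ such that both $G-x$ (delete $x$ and its edges) and $S(x)$ are contractible. A 2-sphere is a finite simple graph in which every unit sphere is a cyclic graph $C_n$ with $n\ge 4$ and such that there is a vertex $x$ with $G-x$ contractible. A 2-ball is a graph of the form $H-x$ where $H$ is a 2-sphere and $x$ a vertex of $H$. The boundary of a 2-ball consists of the vertices whose unit sphere is a path graph (rather than a cycle); these form a cyclic graph (the boundary circle), whose number of edges is the boundary length. An edge $(a,b)$ is interior if not both $a$ and $b$ lie on the boundary. An edge refinement at an edge $(a,b)$ of a graph $(V,E)$ produces the graph with vertex set $V\cup\{c\}$ ($c$ new) and edge set $(E\setminus\{(a,b)\})\cup\{(a,c),(c,b)\}\cup\{(c,u): u\in S(a)\cap S(b)\}$; in a sequence of refinements, "interior edge" refers to the current graph, whose boundary circle is unchanged. -}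

module Defs where

open import Data.Nat using (ℕ; zero; suc; _≤_)
open import Data.Nat.Divisibility using (_∣_)
open import Data.Fin using (Fin; toℕ; zero; suc; punchIn; fromℕ; inject₁; _≟_)
open import Data.Bool using (Bool; true; false; _∧_; _∨_; if_then_else_)
open import Data.List using (length; filterᵇ; allFin)
open import Data.Product using (Σ; _×_; _,_)
open import Data.Sum using (_⊎_)
open import Data.Unit using (⊤)
open import Relation.Nullary using (¬_)
open import Relation.Nullary.Decidable using (⌊_⌋)
open import Relation.Binary.PropositionalEquality using (_≡_; _≢_)
open import Function.Definitions using (Injective)
open import Function.Bundles using (_⇔_)

Adj : ℕ → Set
Adj n = Fin n → Fin n → Bool

IsSimple : ∀ {n} → Adj n → Set
IsSimple {n} g = (∀ i j → g i j ≡ g j i) × (∀ i → g i i ≡ false)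

-- vertex subsets (induced subgraphs are given by a subset of vertices)
VSet : ℕ → Set₁
VSet n = Fin n → Set

Sphere : ∀ {n} → Adj n → VSet n → Fin n → VSet n
Sphere g W x y = W y × g x y ≡ true

Delete : ∀ {n} → VSet n → Fin n → VSet n
Delete W x y = W y × y ≢ x

Full : ∀ {n} → VSet n
Full _ = ⊤

data Contractible {n : ℕ} (g : Adj n) : VSet n → Set₁ where
  k1   : (W : VSet n) (v : Fin n) → W v → (∀ w → W w → w ≡ v) → Contractible g W
  step : (W : VSet n) (x : Fin n) → W x →
         Contractible g (Delete W x) → Contractible g (Sphere g W x) →
         Contractible g W

Succ : (m : ℕ) → Fin m → Fin m → Set
Succ m i j = (suc (toℕ i) ≡ toℕ j) ⊎ ((suc (toℕ i) ≡ m) × (toℕ j ≡ 0))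

CycAdj : (m : ℕ) → Fin m → Fin m → Set
CycAdj m i j = Succ m i j ⊎ Succ m j i

PathAdj : (m : ℕ) → Fin m → Fin m → Set
PathAdj m i j = (suc (toℕ i) ≡ toℕ j) ⊎ (suc (toℕ j) ≡ toℕ i)

IsoTo : ∀ {n} → Adj n → VSet n → (m : ℕ) → (Fin m → Fin m → Set) → Set
IsoTo {n} g W m R =
  Σ (Fin m → Fin n) λ v →
    Injective _≡_ _≡_ v × (∀ i → W (v i)) × (∀ w → W w → Σ (Fin m) λ i → v i ≡ w) ×
    (∀ i j → (g (v i) (v j) ≡ true) ⇔ R i j)

IsCycle : ∀ {n} → Adj n → VSet n → ℕ → Set
IsCycle g W m = 3 ≤ m × IsoTo g W m (CycAdj m)

IsPath : ∀ {n} → Adj n → VSet n → ℕ → Set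
IsPath g W m = 1 ≤ m × IsoTo g W m (PathAdj m)

TwoSphere : ∀ {n} → Adj n → Set₁
TwoSphere {n} g =
  IsSimple g ×
  (∀ x → Σ ℕ λ m → 4 ≤ m × IsCycle g (Sphere g Full x) m) ×
  Σ (Fin n) λ x → Contractible g (Delete Full x)

TwoBall : ∀ {n} → Adj n → Set₁
TwoBall {n} g =
  IsSimple g ×
  Σ (Adj (suc n)) λ h → Σ (Fin (suc n)) λ x →
    TwoSphere h × (∀ i j → g i j ≡ h (punchIn x i) (punchIn x j))

Boundary : ∀ {n} → Adj n → VSet n
Boundary g v = Σ ℕ λ m → IsPath g (Sphere g Full v) m

Interior : ∀ {n} → Adj n → Fin n → Fin n → Set
Interior g a b = ¬ (Boundary g a × Boundary g b)

-- edge refinement at (a,b); the new vertex c is zero, and each old vertex i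
-- becomes suc i (a relabelling; the result is the refined graph up to isomorphism)
_==_ : ∀ {n} → Fin n → Fin n → Bool
i == j = ⌊ i ≟ j ⌋

isEdge : ∀ {n} → Fin n → Fin n → Fin n → Fin n → Bool
isEdge a b i j = (i == a ∧ j == b) ∨ (i == b ∧ j == a)

newAdj : ∀ {n} → Adj n → Fin n → Fin n → Fin n → Bool
newAdj g a b u = u == a ∨ u == b ∨ (g a u ∧ g b u)

refine : ∀ {n} → Adj n → Fin n → Fin n → Adj (suc n)
refine g a b zero    zero    = false
refine g a b zero    (suc u) = newAdj g a b u
refine g a b (suc u) zero    = newAdj g a b u
refine g a b (suc i) (suc j) = if isEdge a b i j then false else g i j

data Refines : ∀ {n m} → Adj n → Adj m → Set where
  done : ∀ {n} (g : Adj n) → Refines g g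
  step : ∀ {n m} (g : Adj n) (h : Adj m) (a b : Fin n) →
         g a b ≡ true → Interior g a b →
         Refines (refine g a b) h → Refines g h

degree : ∀ {n} → Adj n → Fin n → ℕ
degree {n} g v = length (filterᵇ (g v) (allFin n))

AllEven : ∀ {n} → Adj n → Set
AllEven g = ∀ v → 2 ∣ degree g v

{-# OPTIONS --safe #-}
-- G is H minus a vertex x, for a triangulated sphere H; refining an interior edge of G refines H and leaves
-- the link of x alone.
--
-- (⇐) Colour the boundary circle 0, 1, 2, 0, 1, 2, … and the interior arbitrarily. A monochromatic edge can be
-- refined away, after one auxiliary refinement if its two opposite vertices carry the two other colours. Once
-- the colouring is proper, each link in G alternates between two colours, and the two boundary neighbours of a
-- boundary vertex have different colours, so all degrees are even.
--
-- (⇒) If all degrees of the refined G are even, its edge set is a 1-cycle modulo 2 of H, hence the boundary of a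
-- set of triangles of H by the Fredholm alternative, since H¹(H; ℤ/2) = 0. The triangles at x are all inside or
-- all outside this set, say all outside. Counting ordered incidences of edges and triangles, the outside has
-- 4 deg x more than the inside, and both numbers are divisible by 3.
module Submission where

open import Defs
open import Algebra.Bundles using (CommutativeMonoid; module CommutativeRing)
import Algebra.Properties.CommutativeMonoid.Sum as Sums
open import Data.Bool using (Bool; true; false; not; _∧_; _∨_; _xor_; if_then_else_)
open import Data.Bool.Properties
  using (not-involutive; ∧-assoc; ∧-comm; ∧-distribˡ-xor; ∧-distribʳ-xor; ∧-identityʳ; ∧-zeroʳ; ∨-comm; ∨-zeroʳ;
         not-distribˡ-xor; xor-∧-commutativeRing; xor-assoc; xor-comm; xor-identityʳ; xor-same)
  renaming (_≟_ to _≟ᵇ_)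
open import Data.Bool.Solver using (module xor-∧-Solver)
open import Data.Empty using (⊥; ⊥-elim)
open import Data.Fin using (Fin; zero; suc; toℕ; fromℕ<; _≟_; punchIn; punchOut)
open import Data.Fin.Properties
  using (any?; pigeonhole; punchIn-injective; punchIn-punchOut; punchInᵢ≢i; suc-injective; toℕ-fromℕ<;
         toℕ-injective; toℕ<n)
open import Data.List using (List; []; _∷_; allFin; cartesianProduct; filterᵇ; length; tabulate)
open import Data.List.Membership.Propositional using (_∈_)
open import Data.List.Membership.Propositional.Properties using (∈-allFin; ∈-cartesianProduct⁺)
open import Data.List.Relation.Unary.Any using (here; there)
open import Data.Nat using (ℕ; zero; suc; _+_; _*_; _≤_; _<_; z≤n; s≤s)
open import Data.Nat.Divisibility using (_∣_; divides; ∣m∣n⇒∣m+n; ∣m+n∣m⇒∣n; n∣m*n)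
import Data.Nat.Properties as ℕ
open import Data.Nat.Solver using (module +-*-Solver)
open import Data.Product using (Σ; _×_; _,_; proj₁; proj₂)
open import Data.Sum using (_⊎_; inj₁; inj₂)
import Data.Sum as Sum
open import Data.Unit using (tt)
import Data.Vec.Functional as V
open import Function using (_∘_; case_of_; id)
open import Function.Bundles using (_⇔_; mk⇔; module Equivalence)
open import Relation.Binary.Construct.Closure.ReflexiveTransitive
  using (Star; ε; _◅_; _◅◅_; gmap; kleisliStar; reverse)
import Relation.Binary.Construct.Closure.ReflexiveTransitive as Star
open import Relation.Binary.Definitions using (tri<; tri≈; tri>)
open import Relation.Binary.PropositionalEquality
open import Relation.Nullary using (¬_; Dec; yes; no; does)
open import Relation.Nullary.Decidable using (_×-dec_; dec-true; dec-false; map′)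

-- Finite sums

-- Contractibility and the cyclic enumerations of the links are awkward to carry through a
-- refinement. `Surface` replaces them by conditions that are local or linear: two triangles on each
-- edge, connected links, no complete graph on four vertices, and every cocycle modulo 2 a
-- coboundary. For a sphere, the last condition comes from rebuilding it by cones over connected
-- links. `noK4` encodes that links have length at least 4; it keeps the two vertices opposite to a
-- refined edge non-adjacent, so that the link of the new vertex is a 4-cycle.
--
-- A second obstacle is that interior edges are defined through unit spheres that are paths, whereas
-- both directions work with the link of the removed vertex. Walking once around the link of a
-- vertex identifies the two notions of boundary, at every stage of a sequence of refinements.
--
-- In (⇒) no 3-colouring is built. Across an edge of the refined ball the two triangles of the
-- sphere lie on different sides of the filling, and across an edge at the removed vertex on the
-- same side; this imbalance already determines the length modulo 3.

module SumSupport {c} (M : CommutativeMonoid c c) where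
  open CommutativeMonoid M renaming (refl to ≈-refl; sym to ≈-sym; trans to ≈-trans; _∙_ to _⊕_; ε to 0#)
  open Sums M

  sum-zero : ∀ {n} (t : Fin n → Carrier) → (∀ i → t i ≈ 0#) → sum t ≈ 0#
  sum-zero {n} t z = ≈-trans (sum-cong-≋ z) (sum-replicate-zero n)

  sum-single : ∀ {n} (t : Fin n → Carrier) i → (∀ j → j ≢ i → t j ≈ 0#) → sum t ≈ t i
  sum-single {suc n} t i z = ≈-trans (sum-remove {i = i} t)
    (≈-trans (∙-congˡ (sum-zero _ λ j → z (punchIn i j) (punchInᵢ≢i i j))) (identityʳ (t i)))

  sum-pair : ∀ {n} (t : Fin n → Carrier) i j → i ≢ j →
             (∀ k → k ≢ i → k ≢ j → t k ≈ 0#) → sum t ≈ t i ⊕ t j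
  sum-pair {suc n} t i j i≢j z = ≈-trans (sum-remove {i = i} t) (∙-congˡ
    (≈-trans (sum-single (t ∘ punchIn i) (punchOut i≢j) λ k k≢ → z _ (punchInᵢ≢i i k)
       λ e → k≢ (punchIn-injective i k (punchOut i≢j) (trans e (sym (punchIn-punchOut i≢j)))))
      (reflexive (cong t (punchIn-punchOut i≢j)))))

open Sums ℕ.+-0-commutativeMonoid
  using (sum; sum-cong-≗; sum-remove; ∑-distrib-+; ∑-comm)
open SumSupport ℕ.+-0-commutativeMonoid
open import Algebra.Properties.Semiring.Sum ℕ.+-*-semiring using (*-distribˡ-sum)

xor-commutativeMonoid : CommutativeMonoid _ _
xor-commutativeMonoid = CommutativeRing.+-commutativeMonoid xor-∧-commutativeRing

module ⊕ where
  open Sums xor-commutativeMonoid public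
    using (sum; sum-cong-≗; sum-remove; ∑-distrib-+; ∑-comm)
  open SumSupport xor-commutativeMonoid public
  open import Algebra.Properties.Semiring.Sum (CommutativeRing.semiring xor-∧-commutativeRing) public
    using (*-distribˡ-sum; *-distribʳ-sum)

-- Counting and parity

𝟙 : Bool → ℕ
𝟙 b = if b then 1 else 0

count : ∀ {n} → (Fin n → Bool) → ℕ
count p = sum (λ i → 𝟙 (p i))

length-filterᵇ-tabulate : ∀ {n} {A : Set} (p : A → Bool) (f : Fin n → A) →
  length (filterᵇ p (tabulate f)) ≡ count (p ∘ f)
length-filterᵇ-tabulate {zero} p f = refl
length-filterᵇ-tabulate {suc n} p f with p (f zero)
... | true  = cong suc (length-filterᵇ-tabulate p (f ∘ suc))
... | false = length-filterᵇ-tabulate p (f ∘ suc)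

odd : ℕ → Bool
odd zero    = false
odd (suc n) = not (odd n)

odd-+ : ∀ m n → odd (m + n) ≡ odd m xor odd n
odd-+ zero    n = refl
odd-+ (suc m) n = trans (cong not (odd-+ m n)) (not-distribˡ-xor (odd m) (odd n))

even⇒odd≡false : ∀ {n} → 2 ∣ n → odd n ≡ false
even⇒odd≡false (divides q refl) = double q
  where
  double : ∀ q → odd (q * 2) ≡ false
  double zero = refl
  double (suc q) = trans (not-involutive (odd (q * 2))) (double q)

⊕-parity : ∀ {n} (p : Fin n → Bool) → ⊕.sum p ≡ odd (count p)
⊕-parity {zero} p = refl
⊕-parity {suc n} p = trans (cong (p zero xor_) (⊕-parity (p ∘ suc)))
  (trans (cong (_xor odd (count (p ∘ suc))) (odd-𝟙 (p zero))) (sym (odd-+ (𝟙 (p zero)) _)))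
  where
  odd-𝟙 : ∀ b → b ≡ odd (𝟙 b)
  odd-𝟙 true = refl
  odd-𝟙 false = refl

-- Surfaces

xor-move : ∀ x {y z} → y ≡ x xor z → z ≡ x xor y
xor-move true  {z = z} refl = sym (not-involutive z)
xor-move false refl = refl

Two : ∀ {n} → (Fin n → Set) → Set
Two {n} P = Σ (Fin n) λ u → Σ (Fin n) λ w →
  u ≢ w × P u × P w × (∀ z → P z → z ≡ u ⊎ z ≡ w)

Two-cong : ∀ {n} {P Q : Fin n → Set} →
  (∀ {z} → P z → Q z) → (∀ {z} → Q z → P z) → Two P → Two Q
Two-cong f g (u , w , u≢w , pu , pw , only) = u , w , u≢w , f pu , f pw , λ z → only z ∘ g

-- This is how one crosses an edge to the other triangle, or moves on along a link, without
-- numbering the vertices of the link.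
Two-other : ∀ {n} {P : Fin n → Set} → Two P → ∀ {y} → P y →
  Σ (Fin n) λ r → y ≢ r × P r × (∀ z → P z → z ≡ y ⊎ z ≡ r)
Two-other (u , w , u≢w , pu , pw , only) {y} py with only y py
... | inj₁ refl = w , u≢w , pw , only
... | inj₂ refl = u , u≢w ∘ sym , pu , λ z → Sum.swap ∘ only z

Common : ∀ {n} → Adj n → Fin n → Fin n → Fin n → Set
Common h p q z = h p z ≡ true × h q z ≡ true

Common-flip : ∀ {n} (h : Adj n) p q → Two (Common h p q) → Two (Common h q p)
Common-flip h p q = Two-cong (λ (x , y) → y , x) (λ (x , y) → y , x)

Link : ∀ {n} → Adj n → Fin n → Fin n → Fin n → Set
Link h v y z = h v y ≡ true × h v z ≡ true × h y z ≡ true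

-- The 1-cocycles with ℤ/2 coefficients of the complex whose simplices are the vertices, edges and
-- triangles of `h`. The values of `φ` on non-edges are left free.
Flat : ∀ {n} → Adj n → (Fin n → Fin n → Bool) → Set
Flat h φ = (∀ i j → h i j ≡ true → φ i j ≡ φ j i) ×
  (∀ i j k → h i j ≡ true → h j k ≡ true → h i k ≡ true → φ i k ≡ φ i j xor φ j k)

-- The fields two and conn together say that every link is a circle; H¹≡0 is the vanishing of the first
-- cohomology with ℤ/2 coefficients.
record Surface {n} (h : Adj n) : Set where
  field
    symm : ∀ i j → h i j ≡ h j i
    irr  : ∀ i → h i i ≢ true
    two  : ∀ {p q} → h p q ≡ true → Two (Common h p q)
    noK4 : ∀ {i j k l} → h i j ≡ true → h i k ≡ true → h i l ≡ true →
           h j k ≡ true → h j l ≡ true → h k l ≡ true → ⊥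
    conn : ∀ v {y z} → h v y ≡ true → h v z ≡ true → Star (Link h v) y z
    H¹≡0 : ∀ φ → Flat h φ →
           Σ (Fin n → Bool) λ f → ∀ i j → h i j ≡ true → φ i j ≡ f i xor f j

  flip : ∀ {i j} → h i j ≡ true → h j i ≡ true
  flip {i} {j} e = trans (symm j i) e

  distinct : ∀ {i j} → h i j ≡ true → i ≢ j
  distinct e refl = irr _ e

-- Edge refinement

∨-elim : ∀ {x y} → x ∨ y ≡ true → x ≡ true ⊎ y ≡ true
∨-elim {true}  e = inj₁ refl
∨-elim {false} e = inj₂ e

∨-introˡ : ∀ {x} y → x ≡ true → x ∨ y ≡ true
∨-introˡ y refl = refl

∨-introʳ : ∀ x {y} → y ≡ true → x ∨ y ≡ true
∨-introʳ x refl = ∨-zeroʳ x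

∧-elim : ∀ {x y} → x ∧ y ≡ true → x ≡ true × y ≡ true
∧-elim {true} {true} e = refl , refl

∧-intro : ∀ {x y} → x ≡ true → y ≡ true → x ∧ y ≡ true
∧-intro refl refl = refl

==-refl : ∀ {n} (i : Fin n) → i == i ≡ true
==-refl i with i ≟ i
... | yes _ = refl
... | no i≢i = ⊥-elim (i≢i refl)

==-sound : ∀ {n} {i j : Fin n} → i == j ≡ true → i ≡ j
==-sound {i = i} {j} e with i ≟ j
... | yes p = p

==-≢ : ∀ {n} {i j : Fin n} → i ≢ j → i == j ≡ false
==-≢ {i = i} {j} i≢j with i ≟ j
... | yes p = ⊥-elim (i≢j p)
... | no _ = refl

SameEdge : ∀ {n} (a b i j : Fin n) → Set
SameEdge a b i j = (i ≡ a × j ≡ b) ⊎ (i ≡ b × j ≡ a)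

SameEdge-flip : ∀ {n} {a b i j : Fin n} → SameEdge a b i j → SameEdge a b j i
SameEdge-flip (inj₁ (p , q)) = inj₂ (q , p)
SameEdge-flip (inj₂ (p , q)) = inj₁ (q , p)

isEdge-sound : ∀ {n} (a b i j : Fin n) → isEdge a b i j ≡ true → SameEdge a b i j
isEdge-sound a b i j e with ∨-elim {i == a ∧ j == b} e
... | inj₁ p = inj₁ (==-sound (proj₁ (∧-elim p)) , ==-sound (proj₂ (∧-elim {i == a} p)))
... | inj₂ p = inj₂ (==-sound (proj₁ (∧-elim p)) , ==-sound (proj₂ (∧-elim {i == b} p)))

isEdge-complete : ∀ {n} {a b i j : Fin n} → SameEdge a b i j → isEdge a b i j ≡ true
isEdge-complete {a = a} {b} (inj₁ (refl , refl)) = ∨-introˡ _ (∧-intro (==-refl a) (==-refl b))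
isEdge-complete {a = a} {b} (inj₂ (refl , refl)) = ∨-introʳ (b == a ∧ a == b) (∧-intro (==-refl b) (==-refl a))

module _ {n} (h : Adj n) where

  new-left : ∀ a b → newAdj h a b a ≡ true
  new-left a b = ∨-introˡ _ (==-refl a)

  new-right : ∀ a b → newAdj h a b b ≡ true
  new-right a b = ∨-introʳ (b == a) (∨-introˡ _ (==-refl b))

  new-common : ∀ {a b y} → Common h a b y → newAdj h a b y ≡ true
  new-common {a} {b} {y} (ay , by) =
    ∨-introʳ (y == a) (∨-introʳ (y == b) (∧-intro ay by))

  new-elim : ∀ a b y → newAdj h a b y ≡ true → (y ≡ a ⊎ y ≡ b) ⊎ Common h a b y
  new-elim a b y e with ∨-elim {y == a} e
  ... | inj₁ p = inj₁ (inj₁ (==-sound p))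
  ... | inj₂ q with ∨-elim {y == b} q
  ... | inj₁ p = inj₁ (inj₂ (==-sound p))
  ... | inj₂ p = inj₂ (∧-elim p)

  old-intro : ∀ {a b i j} → h i j ≡ true → ¬ SameEdge a b i j →
              refine h a b (suc i) (suc j) ≡ true
  old-intro {a} {b} {i} {j} e ne with isEdge a b i j in eq
  ... | true  = ⊥-elim (ne (isEdge-sound a b i j eq))
  ... | false = e

  old-elim : ∀ a b i j → refine h a b (suc i) (suc j) ≡ true →
             h i j ≡ true × ¬ SameEdge a b i j
  old-elim a b i j e with isEdge a b i j in eq
  ... | false = e , λ s → case trans (sym eq) (isEdge-complete s) of λ ()

  newAdj-swap : ∀ a b y → newAdj h a b y ≡ newAdj h b a y
  newAdj-swap a b y with y == a | y == b | h a y | h b y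
  ... | true  | true  | _ | _ = refl
  ... | true  | false | _ | _ = refl
  ... | false | true  | _ | _ = refl
  ... | false | false | x | y′ = ∧-comm x y′

  refine-swap : ∀ a b i j → refine h a b i j ≡ refine h b a i j
  refine-swap a b zero    zero    = refl
  refine-swap a b zero    (suc j) = newAdj-swap a b j
  refine-swap a b (suc i) zero    = newAdj-swap a b i
  refine-swap a b (suc i) (suc j) =
    cong (if_then false else h i j) (∨-comm (i == a ∧ j == b) (i == b ∧ j == a))

  Two-refine-swap : ∀ a b p q → Two (Common (refine h b a) p q) → Two (Common (refine h a b) p q)
  Two-refine-swap a b p q = Two-cong
    (λ {z} (e , f) → trans (refine-swap a b p z) e , trans (refine-swap a b q z) f)
    (λ {z} (e , f) → trans (refine-swap b a p z) e , trans (refine-swap b a q z) f)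

-- Refining an edge of a surface gives a surface

module _ {n} {h : Adj n} (S : Surface h) where
  open Surface S

  refine-sym : ∀ a b i j → refine h a b i j ≡ refine h a b j i
  refine-sym a b zero    zero    = refl
  refine-sym a b zero    (suc j) = refl
  refine-sym a b (suc i) zero    = refl
  refine-sym a b (suc i) (suc j) = cong₂ (if_then false else_) (lemma (i == a) (j == b) (i == b) (j == a)) (symm i j)
    where
    lemma : ∀ x y z w → (x ∧ y) ∨ (z ∧ w) ≡ (w ∧ z) ∨ (y ∧ x)
    lemma x y z w = trans (∨-comm (x ∧ y) (z ∧ w)) (cong₂ _∨_ (∧-comm z w) (∧-comm x y))

  refine-irr : ∀ a b i → refine h a b i i ≢ true
  refine-irr a b zero    ()
  refine-irr a b (suc i) e = irr i (proj₁ (old-elim h a b i i e))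

  module _ {a b : Fin n} (ab : h a b ≡ true) where
    private
      h′ = refine h a b

    -- The link of the new vertex is bipartite, with `a` and `b` on one side and their common
    -- neighbours on the other: the edge between `a` and `b` has been removed, and an edge between
    -- two common neighbours would violate `noK4`.
    mixed : ∀ p q → newAdj h a b p ≡ true → newAdj h a b q ≡ true → h′ (suc p) (suc q) ≡ true →
            ((p ≡ a ⊎ p ≡ b) × Common h a b q) ⊎ (Common h a b p × (q ≡ a ⊎ q ≡ b))
    mixed p q np nq e with new-elim h a b p np | new-elim h a b q nq | old-elim h a b p q e
    ... | inj₁ p  | inj₂ q  | _ = inj₁ (p , q)
    ... | inj₂ p  | inj₁ q  | _ = inj₂ (p , q)
    ... | inj₂ (ap , bp) | inj₂ (aq , bq) | pq , _ = ⊥-elim (noK4 ab ap aq bp bq pq)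
    ... | inj₁ (inj₁ refl) | inj₁ (inj₁ refl) | pq , _ = ⊥-elim (irr _ pq)
    ... | inj₁ (inj₂ refl) | inj₁ (inj₂ refl) | pq , _ = ⊥-elim (irr _ pq)
    ... | inj₁ (inj₁ refl) | inj₁ (inj₂ refl) | _ , ne = ⊥-elim (ne (inj₁ (refl , refl)))
    ... | inj₁ (inj₂ refl) | inj₁ (inj₁ refl) | _ , ne = ⊥-elim (ne (inj₂ (refl , refl)))

    end≢common : ∀ {p} → p ≡ a ⊎ p ≡ b → ¬ Common h a b p
    end≢common (inj₁ refl) (aa , _) = irr _ aa
    end≢common (inj₂ refl) (_ , bb) = irr _ bb

    noTriangle : ∀ p q r → newAdj h a b p ≡ true → newAdj h a b q ≡ true → newAdj h a b r ≡ true →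
                 h′ (suc p) (suc q) ≡ true → h′ (suc p) (suc r) ≡ true → h′ (suc q) (suc r) ≡ true → ⊥
    noTriangle p q r np nq nr pq pr qr with mixed p q np nq pq | mixed p r np nr pr | mixed q r nq nr qr
    ... | inj₁ (p , _) | inj₂ (p′ , _) | _ = end≢common p p′
    ... | inj₂ (p′ , _) | inj₁ (p , _) | _ = end≢common p p′
    ... | inj₁ (_ , q′) | inj₁ _ | inj₁ (q , _) = end≢common q q′
    ... | inj₁ _ | inj₁ (_ , r′) | inj₂ (_ , r) = end≢common r r′
    ... | inj₂ _ | inj₂ (_ , r) | inj₁ (_ , r′) = end≢common r r′
    ... | inj₂ (_ , q) | inj₂ _ | inj₂ (q′ , _) = end≢common q q′

    refine-noK4 : ∀ {i j k l} → h′ i j ≡ true → h′ i k ≡ true → h′ i l ≡ true →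
                  h′ j k ≡ true → h′ j l ≡ true → h′ k l ≡ true → ⊥
    refine-noK4 {zero} {suc j} {suc k} {suc l} ij ik il jk jl kl = noTriangle j k l ij ik il jk jl kl
    refine-noK4 {suc i} {zero} {suc k} {suc l} ij ik il jk jl kl = noTriangle i k l ij jk jl ik il kl
    refine-noK4 {suc i} {suc j} {zero} {suc l} ij ik il jk jl kl = noTriangle i j l ik jk kl ij il jl
    refine-noK4 {suc i} {suc j} {suc k} {zero} ij ik il jk jl kl = noTriangle i j k il jl kl ij ik jk
    refine-noK4 {suc i} {suc j} {suc k} {suc l} ij ik il jk jl kl =
      noK4 (o i j ij) (o i k ik) (o i l il) (o j k jk) (o j l jl) (o k l kl)
      where
      o : ∀ i j → h′ (suc i) (suc j) ≡ true → h i j ≡ true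
      o i j e = proj₁ (old-elim h a b i j e)

    two-new-common : ∀ {y} → Common h a b y → Two (Common h′ zero (suc y))
    two-new-common {y} (ay , by) =
      suc a , suc b , distinct ab ∘ suc-injective ,
      (new-left h a b , old-intro h (flip ay) λ { (inj₁ (_ , refl)) → irr _ ab ; (inj₂ (refl , _)) → irr _ by }) ,
      (new-right h a b , old-intro h (flip by) λ { (inj₁ (refl , _)) → irr _ ay ; (inj₂ (_ , refl)) → irr _ ab }) ,
      only
      where
      only : ∀ z → Common h′ zero (suc y) z → z ≡ suc a ⊎ z ≡ suc b
      only (suc z) (nz , yz) with mixed y z (new-common h (ay , by)) nz yz
      ... | inj₁ (e , c) = ⊥-elim (end≢common e (ay , by))
      ... | inj₂ (_ , e) = Sum.map (cong suc) (cong suc) e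

    -- The old triangles on such an edge survive: if one of them contained the refined edge, `p` and
    -- `q` would both be neighbours of the new vertex.
    two-generic : ∀ p q → h′ (suc p) (suc q) ≡ true →
                  ¬ (newAdj h a b p ≡ true × newAdj h a b q ≡ true) →
                  Two (Common h′ (suc p) (suc q))
    two-generic p q e far with old-elim h a b p q e
    ... | pq , _ with two pq
    ... | u , w , u≢w , cu , cw , only =
      suc u , suc w , u≢w ∘ suc-injective , lift cu , lift cw , only′
      where
      lift : ∀ {z} → Common h p q z → Common h′ (suc p) (suc q) (suc z)
      lift {z} (pz , qz) =
        old-intro h pz
          (λ { (inj₁ (refl , refl)) → far (new-left h p z , new-common h (pq , flip qz))
             ; (inj₂ (refl , refl)) → far (new-right h z p , new-common h (flip qz , pq)) }) ,
        old-intro h qz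
          (λ { (inj₁ (refl , refl)) → far (new-common h (flip pq , flip pz) , new-left h q z)
             ; (inj₂ (refl , refl)) → far (new-common h (flip pz , flip pq) , new-right h z q) })
      only′ : ∀ z → Common h′ (suc p) (suc q) z → z ≡ suc u ⊎ z ≡ suc w
      only′ zero    c = ⊥-elim (far c)
      only′ (suc z) (pz , qz) =
        Sum.map (cong suc) (cong suc) (only z (proj₁ (old-elim h a b p z pz) , proj₁ (old-elim h a b q z qz)))

  two-new-end : ∀ {a b} → h a b ≡ true → Two (Common (refine h a b) zero (suc a))
  two-new-end {a} {b} ab with two ab
  ... | u , w , u≢w , cu , cw , only =
    suc u , suc w , u≢w ∘ suc-injective , lift cu , lift cw , only′
    where
    lift : ∀ {z} → Common h a b z → Common (refine h a b) zero (suc a) (suc z)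
    lift (az , bz) = new-common h (az , bz) ,
      old-intro h az λ { (inj₁ (_ , refl)) → irr _ bz ; (inj₂ (_ , refl)) → irr _ az }
    only′ : ∀ z → Common (refine h a b) zero (suc a) z → z ≡ suc u ⊎ z ≡ suc w
    only′ (suc z) (nz , az) with mixed ab a z (new-left h a b) nz az
    ... | inj₁ (_ , c) = Sum.map (cong suc) (cong suc) (only z c)
    ... | inj₂ (c , _) = ⊥-elim (end≢common ab (inj₁ refl) c)

  -- The triangle on `a`, `b`, `y` is halved, so the new vertex takes the place of `b` opposite to
  -- this edge; the triangle on its other side, with third vertex `r`, is untouched.
  two-cut-side : ∀ {a b y} → h a b ≡ true → Common h a b y → Two (Common (refine h a b) (suc a) (suc y))
  two-cut-side {a} {b} {y} ab (ay , by) with Two-other (two ay) {b} (ab , flip by)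
  ... | r , b≢r , (ar , yr) , only =
    zero , suc r , (λ ()) , (new-left h a b , new-common h (ay , by)) ,
    (old-intro h ar (λ { (inj₁ (_ , refl)) → b≢r refl ; (inj₂ (_ , refl)) → irr _ ar }) ,
     old-intro h yr (λ { (inj₁ (refl , _)) → irr _ ay ; (inj₂ (refl , _)) → irr _ by })) ,
    only′
    where
    only′ : ∀ z → Common (refine h a b) (suc a) (suc y) z → z ≡ zero ⊎ z ≡ suc r
    only′ zero    _ = inj₁ refl
    only′ (suc z) (az , yz) with old-elim h a b a z az
    ... | az′ , ne with only z (az′ , proj₁ (old-elim h a b y z yz))
    ... | inj₁ refl = ⊥-elim (ne (inj₁ (refl , refl)))
    ... | inj₂ refl = inj₂ refl

  refine-two : ∀ {a b} → h a b ≡ true → ∀ {p q} → refine h a b p q ≡ true →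
               Two (Common (refine h a b) p q)
  refine-two {a} {b} ab {zero} {suc q} e with new-elim h a b q e
  ... | inj₁ (inj₁ refl) = two-new-end ab
  ... | inj₁ (inj₂ refl) = Two-refine-swap h a b zero (suc b) (two-new-end (flip ab))
  ... | inj₂ c = two-new-common ab c
  refine-two {a} {b} ab {suc p} {zero} e =
    Common-flip (refine h a b) zero (suc p) (refine-two ab {zero} {suc p} e)
  refine-two {a} {b} ab {suc p} {suc q} e
    with newAdj h a b p in np | newAdj h a b q in nq
  ... | false | _ = two-generic ab p q e λ (x , _) → case trans (sym np) x of λ ()
  ... | true | false = two-generic ab p q e λ (_ , x) → case trans (sym nq) x of λ ()
  ... | true | true with mixed ab p q np nq e
  ... | inj₁ (inj₁ refl , c) = two-cut-side ab c
  ... | inj₁ (inj₂ refl , (x , y)) = Two-refine-swap h a b (suc b) (suc q) (two-cut-side (flip ab) (y , x))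
  ... | inj₂ (c , inj₁ refl) = Common-flip (refine h a b) (suc a) (suc p) (two-cut-side ab c)
  ... | inj₂ ((x , y) , inj₂ refl) = Common-flip (refine h a b) (suc b) (suc p)
                                   (Two-refine-swap h a b (suc b) (suc p) (two-cut-side (flip ab) (y , x)))

  -- The cocycle is transported to `h` by giving the removed edge its value `t` along the path from
  -- `a` to `b` through the new vertex. A potential on `h` then extends to the new vertex by the
  -- value that the edge from `a` dictates.
  refine-H¹≡0 : ∀ {a b} → h a b ≡ true → ∀ φ → Flat (refine h a b) φ →
    Σ (Fin (suc n) → Bool) λ f → ∀ i j → refine h a b i j ≡ true → φ i j ≡ f i xor f j
  refine-H¹≡0 {a} {b} ab φ (φ-sym , φ-flat) = f′ , exact
    where
    h′ = refine h a b

    t : Bool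
    t = φ (suc a) zero xor φ zero (suc b)

    φ₀ : Fin n → Fin n → Bool
    φ₀ i j = if isEdge a b i j then t else φ (suc i) (suc j)

    φ₀-ab : φ₀ a b ≡ t
    φ₀-ab rewrite isEdge-complete {a = a} {b} (inj₁ (refl , refl)) = refl

    φ₀-old : ∀ {i j} → h′ (suc i) (suc j) ≡ true → φ₀ i j ≡ φ (suc i) (suc j)
    φ₀-old {i} {j} e with isEdge a b i j
    ... | false = refl

    φ₀-sym : ∀ i j → h i j ≡ true → φ₀ i j ≡ φ₀ j i
    φ₀-sym i j ij with isEdge a b i j in p | isEdge a b j i in q
    ... | true  | true  = refl
    ... | true  | false = case trans (sym q) (isEdge-complete (SameEdge-flip (isEdge-sound a b i j p))) of λ ()
    ... | false | true  = case trans (sym p) (isEdge-complete (SameEdge-flip (isEdge-sound a b j i q))) of λ ()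
    ... | false | false = φ-sym (suc i) (suc j) (old-intro h ij λ s → case trans (sym p) (isEdge-complete s) of λ ())

    side-a : ∀ {k} → Common h a b k → h′ (suc a) (suc k) ≡ true
    side-a (ak , bk) = old-intro h ak λ { (inj₁ (_ , refl)) → irr _ bk ; (inj₂ (_ , refl)) → irr _ ak }

    side-b : ∀ {k} → Common h a b k → h′ (suc b) (suc k) ≡ true
    side-b (ak , bk) = old-intro h bk λ { (inj₁ (_ , refl)) → irr _ bk ; (inj₂ (_ , refl)) → irr _ ak }

    -- The sum of the cocycle conditions on the two halves of the triangle; the contributions of the
    -- edge from the new vertex to `k` cancel.
    key : ∀ {k} → Common h a b k → φ₀ a k ≡ φ₀ a b xor φ₀ b k
    key {k} c = begin
      φ₀ a k                                             ≡⟨ φ₀-old (side-a c) ⟩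
      φ (suc a) (suc k)                                  ≡⟨ φ-flat _ _ _ (new-left h a b) (new-common h c) (side-a c) ⟩
      φ (suc a) zero xor φ zero (suc k)                  ≡⟨ cong (φ (suc a) zero xor_) (φ-flat _ _ _ (new-right h a b) (side-b c) (new-common h c)) ⟩
      φ (suc a) zero xor (φ zero (suc b) xor φ (suc b) (suc k)) ≡⟨ xor-assoc (φ (suc a) zero) _ _ ⟨
      t xor φ (suc b) (suc k)                            ≡⟨ cong₂ _xor_ φ₀-ab (φ₀-old (side-b c)) ⟨
      φ₀ a b xor φ₀ b k                                  ∎
      where open ≡-Reasoning

    Δ : Fin n → Fin n → Fin n → Set
    Δ i j k = φ₀ i k ≡ φ₀ i j xor φ₀ j k

    -- With `Δ-rev` this generates all permutations of the three vertices, so a triangle that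
    -- contains the refined edge can be brought into the order required by `key`.
    Δ-swap : ∀ {i j k} → h i j ≡ true → Δ i j k → Δ j i k
    Δ-swap {i} {j} {k} ij e = trans (xor-move (φ₀ i j) e) (cong (_xor φ₀ i k) (φ₀-sym i j ij))

    Δ-rev : ∀ {i j k} → h i j ≡ true → h j k ≡ true → h i k ≡ true → Δ i j k → Δ k j i
    Δ-rev {i} {j} {k} ij jk ik e = begin
      φ₀ k i              ≡⟨ φ₀-sym i k ik ⟨
      φ₀ i k              ≡⟨ e ⟩
      φ₀ i j xor φ₀ j k   ≡⟨ xor-comm (φ₀ i j) (φ₀ j k) ⟩
      φ₀ j k xor φ₀ i j   ≡⟨ cong₂ _xor_ (φ₀-sym j k jk) (φ₀-sym i j ij) ⟩
      φ₀ k j xor φ₀ j i   ∎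
      where open ≡-Reasoning

    split : ∀ i j → h i j ≡ true → SameEdge a b i j ⊎ h′ (suc i) (suc j) ≡ true
    split i j ij with isEdge a b i j in p
    ... | true  = inj₁ (isEdge-sound a b i j p)
    ... | false = inj₂ ij

    φ₀-flat : ∀ i j k → h i j ≡ true → h j k ≡ true → h i k ≡ true → Δ i j k
    φ₀-flat i j k ij jk ik with split i j ij
    ... | inj₁ (inj₁ (refl , refl)) = key (ik , jk)
    ... | inj₁ (inj₂ (refl , refl)) = Δ-swap ab (key (jk , ik))
    ... | inj₂ ij′ with split j k jk
    ... | inj₁ (inj₁ (refl , refl)) =
      Δ-rev (flip ab) (flip ij) (flip ik) (Δ-swap ab (key (flip ij , flip ik)))
    ... | inj₁ (inj₂ (refl , refl)) = Δ-rev ab (flip ij) (flip ik) (key (flip ik , flip ij))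
    ... | inj₂ jk′ with split i k ik
    ... | inj₁ (inj₁ (refl , refl)) =
      Δ-swap (flip ij) (Δ-rev (flip ab) ij (flip jk) (Δ-swap ab (key (ij , flip jk))))
    ... | inj₁ (inj₂ (refl , refl)) =
      Δ-rev (flip jk) (flip ij) ab
        (Δ-swap jk (Δ-rev (flip ab) (flip jk) ij (Δ-swap ab (key (flip jk , ij)))))
    ... | inj₂ ik′ = begin
      φ₀ i k                                            ≡⟨ φ₀-old ik′ ⟩
      φ (suc i) (suc k)                                 ≡⟨ φ-flat _ _ _ ij′ jk′ ik′ ⟩
      φ (suc i) (suc j) xor φ (suc j) (suc k)           ≡⟨ cong₂ _xor_ (φ₀-old ij′) (φ₀-old jk′) ⟨
      φ₀ i j xor φ₀ j k                                 ∎
      where open ≡-Reasoning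

    f = proj₁ (H¹≡0 φ₀ (φ₀-sym , φ₀-flat))
    f-exact = proj₂ (H¹≡0 φ₀ (φ₀-sym , φ₀-flat))

    f′ : Fin (suc n) → Bool
    f′ zero    = f a xor φ (suc a) zero
    f′ (suc i) = f i

    from-new : ∀ y → newAdj h a b y ≡ true → φ zero (suc y) ≡ f′ zero xor f y
    from-new y ny with new-elim h a b y ny
    ... | inj₁ (inj₁ refl) = trans (φ-sym zero (suc a) ny)
      (trans (xor-move (f a) refl) (xor-comm (f a) (f′ zero)))
    ... | inj₁ (inj₂ refl) = begin
      φ zero (suc b)                                  ≡⟨ xor-move (φ (suc a) zero) φ₀-ab ⟩
      φ (suc a) zero xor φ₀ a b                       ≡⟨ cong (φ (suc a) zero xor_) (f-exact a b ab) ⟩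
      φ (suc a) zero xor (f a xor f b)                ≡⟨ xor-assoc (φ (suc a) zero) (f a) (f b) ⟨
      (φ (suc a) zero xor f a) xor f b                ≡⟨ cong (_xor f b) (xor-comm (φ (suc a) zero) (f a)) ⟩
      f′ zero xor f b                                 ∎
      where open ≡-Reasoning
    ... | inj₂ c = begin
      φ zero (suc y)                                  ≡⟨ xor-move (φ (suc a) zero) (φ-flat _ _ _ (new-left h a b) ny (side-a c)) ⟩
      φ (suc a) zero xor φ (suc a) (suc y)            ≡⟨ cong (φ (suc a) zero xor_) (trans (sym (φ₀-old (side-a c))) (f-exact a y (proj₁ c))) ⟩
      φ (suc a) zero xor (f a xor f y)                ≡⟨ xor-assoc (φ (suc a) zero) (f a) (f y) ⟨
      (φ (suc a) zero xor f a) xor f y                ≡⟨ cong (_xor f y) (xor-comm (φ (suc a) zero) (f a)) ⟩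
      f′ zero xor f y                                 ∎
      where open ≡-Reasoning

    exact : ∀ i j → h′ i j ≡ true → φ i j ≡ f′ i xor f′ j
    exact zero    (suc j) e = from-new j e
    exact (suc i) zero    e = trans (φ-sym (suc i) zero e) (trans (from-new i e) (xor-comm (f′ zero) (f i)))
    exact (suc i) (suc j) e = trans (sym (φ₀-old e)) (f-exact i j (proj₁ (old-elim h a b i j e)))

  module _ {a b : Fin n} (ab : h a b ≡ true) where
    private
      h′ = refine h a b

    refine-Link-sym : ∀ v y z → Link h′ v y z → Link h′ v z y
    refine-Link-sym v y z (p , q , r) = q , p , trans (refine-sym a b z y) r

    link-new : ∀ y → h′ zero y ≡ true → Star (Link h′ zero) (suc a) y
    link-new (suc y) ny with new-elim h a b y ny | two ab
    ... | inj₁ (inj₁ refl) | _ = ε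
    ... | inj₁ (inj₂ refl) | u , _ , _ , (au , bu) , _ =
      _◅_ {j = suc u} to-u (refine-Link-sym zero (suc b) (suc u) from-u ◅ ε)
      where
      to-u : Link h′ zero (suc a) (suc u)
      to-u = new-left h a b , new-common h (au , bu) ,
        old-intro h au λ { (inj₁ (_ , refl)) → irr _ bu ; (inj₂ (_ , refl)) → irr _ au }
      from-u : Link h′ zero (suc b) (suc u)
      from-u = new-right h a b , new-common h (au , bu) ,
        old-intro h bu λ { (inj₁ (_ , refl)) → irr _ bu ; (inj₂ (_ , refl)) → irr _ au }
    ... | inj₂ (ay , by) | _ = (new-left h a b , ny ,
        old-intro h ay λ { (inj₁ (_ , refl)) → irr _ by ; (inj₂ (_ , refl)) → irr _ ay }) ◅ ε

    private
      -- The link of `a` changes only by a renaming: the new vertex replaces `b`.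
      lift : Fin n → Fin (suc n)
      lift y = if y == b then zero else suc y

      lift-b : lift b ≡ zero
      lift-b rewrite ==-refl b = refl

      lift-≢ : ∀ {y} → y ≢ b → lift y ≡ suc y
      lift-≢ y≢b rewrite ==-≢ y≢b = refl

      lift-onto : ∀ y → h′ (suc a) y ≡ true → Σ (Fin n) λ y₀ → h a y₀ ≡ true × lift y₀ ≡ y
      lift-onto zero    e = b , ab , lift-b
      lift-onto (suc y) e with old-elim h a b a y e
      ... | ay , ne = y , ay , lift-≢ λ { refl → ne (inj₁ (refl , refl)) }

      a-old : ∀ {y} → h a y ≡ true → y ≢ b → h′ (suc a) (suc y) ≡ true
      a-old ay y≢b = old-intro h ay λ { (inj₁ (_ , e)) → y≢b e ; (inj₂ (_ , refl)) → irr _ ay }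

      lift-link : ∀ {y z} → Link h a y z → Link h′ (suc a) (lift y) (lift z)
      lift-link {y} {z} (ay , az , yz) with y ≟ b | z ≟ b
      ... | yes refl | yes refl = ⊥-elim (irr _ yz)
      ... | yes refl | no z≢b = new-left h a b , a-old az z≢b , new-common h (az , yz)
      ... | no y≢b | yes refl = a-old ay y≢b , new-left h a b , new-common h (ay , flip yz)
      ... | no y≢b | no z≢b = a-old ay y≢b , a-old az z≢b ,
        old-intro h yz λ { (inj₁ (refl , _)) → irr _ ay ; (inj₂ (refl , _)) → y≢b refl }

    link-end : ∀ {y z} → h′ (suc a) y ≡ true → h′ (suc a) z ≡ true → Star (Link h′ (suc a)) y z
    link-end {y} {z} ay az with lift-onto y ay | lift-onto z az
    ... | y₀ , ay₀ , refl | z₀ , az₀ , refl = gmap lift lift-link (conn a ay₀ az₀)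

    -- If `v` is a common neighbour of `a` and `b`, its link has the edge between them subdivided by
    -- the new vertex; otherwise the link is unchanged. Either way, old paths lift, and the new
    -- vertex is attached to `a`.
    link-other : ∀ {v} → v ≢ a → v ≢ b → ∀ y z → h′ (suc v) y ≡ true → h′ (suc v) z ≡ true →
                 Star (Link h′ (suc v)) y z
    link-other {v} v≢a v≢b = λ where
        (suc y) (suc z) vy vz → lifted (conn v (old vy) (old vz))
        zero    zero    vy vz → ε
        zero    (suc z) vy vz → out-new (common vy) ◅ lifted (conn v (flip (proj₁ (common vy))) (old vz))
        (suc y) zero    vy vz → lifted (conn v (old vy) (flip (proj₁ (common vz)))) ◅◅ (to-new (common vz) ◅ ε)
      where
      old : ∀ {y} → h′ (suc v) (suc y) ≡ true → h v y ≡ true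
      old {y} e = proj₁ (old-elim h a b v y e)

      keep : ∀ {y} → h v y ≡ true → h′ (suc v) (suc y) ≡ true
      keep vy = old-intro h vy λ { (inj₁ (e , _)) → v≢a e ; (inj₂ (e , _)) → v≢b e }

      common : newAdj h a b v ≡ true → Common h a b v
      common e with new-elim h a b v e
      ... | inj₁ (inj₁ e) = ⊥-elim (v≢a e)
      ... | inj₁ (inj₂ e) = ⊥-elim (v≢b e)
      ... | inj₂ c = c

      to-new : Common h a b v → Link h′ (suc v) (suc a) zero
      to-new c = keep (flip (proj₁ c)) , new-common h c , new-left h a b

      out-new : Common h a b v → Link h′ (suc v) zero (suc a)
      out-new c = new-common h c , keep (flip (proj₁ c)) , new-left h a b

      step′ : ∀ {y z} → Link h v y z → Star (Link h′ (suc v)) (suc y) (suc z)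
      step′ {y} {z} (vy , vz , yz) with isEdge a b y z in eq
      ... | false = (keep vy , keep vz , old-intro h yz λ s → case trans (sym eq) (isEdge-complete s) of λ ()) ◅ ε
      ... | true with isEdge-sound a b y z eq
      ... | inj₁ (refl , refl) =
        _◅_ {j = zero} (to-new (flip vy , flip vz))
          ((new-common h (flip vy , flip vz) , keep vz , new-right h a b) ◅ ε)
      ... | inj₂ (refl , refl) =
        _◅_ {j = zero} (keep vy , new-common h (flip vz , flip vy) , new-right h a b)
          (out-new (flip vz , flip vy) ◅ ε)

      lifted : ∀ {y z} → Star (Link h v) y z → Star (Link h′ (suc v)) (suc y) (suc z)
      lifted = kleisliStar suc step′

  refine-conn : ∀ {a b} → h a b ≡ true → ∀ v {y z} → refine h a b v y ≡ true → refine h a b v z ≡ true →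
                Star (Link (refine h a b) v) y z
  refine-conn ab zero {y} {z} ny nz =
    reverse (λ {y} {z} → refine-Link-sym ab zero y z) (link-new ab y ny) ◅◅ link-new ab z nz
  refine-conn {a} {b} ab (suc v) {y} {z} vy vz with v ≟ a | v ≟ b
  ... | yes refl | _ = link-end ab vy vz
  ... | no _ | yes refl = gmap (λ y → y) (λ {y} {z} (p , q , r) → sw (suc b) y p , sw (suc b) z q , sw y z r)
    (link-end (flip ab) (trans (refine-swap h b a (suc b) y) vy) (trans (refine-swap h b a (suc b) z) vz))
    where
    sw : ∀ y z → refine h b a y z ≡ true → refine h a b y z ≡ true
    sw y z e = trans (refine-swap h a b y z) e
  ... | no v≢a | no v≢b = link-other ab v≢a v≢b y z vy vz

refine-surface : ∀ {n} {h : Adj n} → Surface h → ∀ {a b} → h a b ≡ true → Surface (refine h a b)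
refine-surface S {a} {b} ab = record
  { symm = refine-sym S a b
  ; irr  = refine-irr S a b
  ; two  = λ {p} {q} → refine-two S ab {p} {q}
  ; noK4 = λ {i} {j} {k} {l} → refine-noK4 S ab {i} {j} {k} {l}
  ; conn = λ v {y} {z} → refine-conn S ab v {y} {z}
  ; H¹≡0 = refine-H¹≡0 S ab
  }

-- Cyclic successor

Succ-unique : ∀ {m} {i j k : Fin m} → Succ m i j → Succ m i k → j ≡ k
Succ-unique (inj₁ p) (inj₁ q) = toℕ-injective (trans (sym p) q)
Succ-unique {j = j} (inj₁ p) (inj₂ (q , _)) = ⊥-elim (ℕ.<⇒≢ (toℕ<n j) (trans (sym p) q))
Succ-unique {k = k} (inj₂ (p , _)) (inj₁ q) = ⊥-elim (ℕ.<⇒≢ (toℕ<n k) (trans (sym q) p))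
Succ-unique (inj₂ (_ , p)) (inj₂ (_ , q)) = toℕ-injective (trans p (sym q))

Pred-unique : ∀ {m} {i j k : Fin m} → Succ m j i → Succ m k i → j ≡ k
Pred-unique (inj₁ p) (inj₁ q) = toℕ-injective (ℕ.suc-injective (trans p (sym q)))
Pred-unique (inj₁ p) (inj₂ (_ , q)) = case trans p q of λ ()
Pred-unique (inj₂ (_ , p)) (inj₁ q) = case trans q p of λ ()
Pred-unique (inj₂ (p , _)) (inj₂ (q , _)) = toℕ-injective (ℕ.suc-injective (trans p (sym q)))

next : ∀ {m} (i : Fin m) → Σ (Fin m) (Succ m i)
next {suc m} i with suc (toℕ i) ℕ.<? suc m
... | yes lt = fromℕ< lt , inj₁ (sym (toℕ-fromℕ< lt))
... | no ≮ = zero , inj₂ (ℕ.≤-antisym (toℕ<n i) (ℕ.≮⇒≥ ≮) , refl)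

prev : ∀ {m} (i : Fin m) → Σ (Fin m) λ j → Succ m j i
prev {suc m} zero = fromℕ< (ℕ.n<1+n m) , inj₂ (cong suc (toℕ-fromℕ< (ℕ.n<1+n m)) , refl)
prev {suc m} (suc i) = fromℕ< i<1+m , inj₁ (cong suc (toℕ-fromℕ< i<1+m))
  where
  i<1+m : toℕ i < suc m
  i<1+m = ℕ.m<n⇒m<1+n (toℕ<n i)

no-2-cycle : ∀ {m} {i j : Fin m} → 3 ≤ m → Succ m i j → ¬ Succ m j i
no-2-cycle 3≤m (inj₁ p) (inj₁ q) = ℕ.<-asym (ℕ.≤-reflexive p) (ℕ.≤-reflexive q)
no-2-cycle 3≤m (inj₁ p) (inj₂ (q , r)) rewrite r = 
  ℕ.<⇒≢ 3≤m (trans (cong suc p) q)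
no-2-cycle 3≤m (inj₂ (p , q)) (inj₁ r) rewrite q = ℕ.<⇒≢ 3≤m (trans (cong suc r) p)
no-2-cycle 3≤m (inj₂ (p , q)) (inj₂ (r , s)) rewrite q = ℕ.<⇒≢ (ℕ.<⇒≤ 3≤m) r

no-3-cycle : ∀ {m} {i j k : Fin m} → 4 ≤ m → Succ m i j → Succ m j k → ¬ Succ m k i
no-3-cycle 4≤m (inj₁ p) (inj₁ q) (inj₁ r) =
  ℕ.<-asym (ℕ.<-trans (ℕ.≤-reflexive p) (ℕ.≤-reflexive q)) (ℕ.≤-reflexive r)
no-3-cycle 4≤m (inj₁ p) (inj₁ q) (inj₂ (r , s)) rewrite s =
  ℕ.<⇒≢ 4≤m (trans (cong suc (trans (cong suc p) q)) r)
no-3-cycle 4≤m (inj₁ p) (inj₂ (q , r)) (inj₁ s) rewrite r =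
  ℕ.<⇒≢ 4≤m (trans (cong suc (trans (cong suc s) p)) q)
no-3-cycle 4≤m (inj₂ (p , q)) (inj₁ r) (inj₁ s) rewrite q =
  ℕ.<⇒≢ 4≤m (trans (cong suc (trans (cong suc r) s)) p)
no-3-cycle 4≤m (inj₁ p) (inj₂ (q , r)) (inj₂ (s , t)) rewrite r =
  ℕ.<⇒≢ (ℕ.<⇒≤ (ℕ.<⇒≤ 4≤m)) s
no-3-cycle 4≤m (inj₂ (p , q)) (inj₁ r) (inj₂ (s , t)) rewrite t =
  ℕ.<⇒≢ (ℕ.<⇒≤ (ℕ.<⇒≤ 4≤m)) p
no-3-cycle 4≤m (inj₂ (p , q)) (inj₂ (r , s)) t rewrite q =
  ℕ.<⇒≢ (ℕ.<⇒≤ (ℕ.<⇒≤ 4≤m)) r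

Succ-irr : ∀ {m} {i : Fin m} → 2 ≤ m → ¬ Succ m i i
Succ-irr 2≤m (inj₁ p) = ℕ.1+n≢n p
Succ-irr 2≤m (inj₂ (p , q)) rewrite q = ℕ.<⇒≢ 2≤m p

cycle-from-0 : ∀ {m} k (i j : Fin m) → toℕ i ≡ 0 → toℕ j ≡ k → Star (CycAdj m) i j
cycle-from-0 zero i j p q with toℕ-injective {i = i} {j} (trans p (sym q))
... | refl = ε
cycle-from-0 {suc m} (suc k) i (suc j) p q =
  cycle-from-0 k i (proj₁ (prev (suc j))) p
    (trans (toℕ-fromℕ< _) (ℕ.suc-injective q)) ◅◅ (inj₁ (proj₂ (prev (suc j))) ◅ ε)

CycAdj-sym : ∀ {m} {i j : Fin m} → CycAdj m i j → CycAdj m j i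
CycAdj-sym (inj₁ p) = inj₂ p
CycAdj-sym (inj₂ p) = inj₁ p

cycle-connected : ∀ {m} (i j : Fin m) → Star (CycAdj m) i j
cycle-connected {suc m} i j =
  reverse CycAdj-sym (cycle-from-0 _ zero i refl refl) ◅◅ cycle-from-0 _ zero j refl refl

-- Contractible graphs

Path-in : ∀ {n} → Adj n → VSet n → Fin n → Fin n → Set
Path-in g W = Star λ y z → W y × W z × g y z ≡ true

module _ {n} {g : Adj n} (simple : IsSimple g) where
  private
    g-sym = proj₁ simple
    g-irr = proj₂ simple

  Path-rev : ∀ {W : VSet n} {y z} → Path-in g W y z → Path-in g W z y
  Path-rev = reverse λ {y} {z} (p , q , r) → q , p , trans (g-sym z y) r

  contractible-inhabited : ∀ {W} → Contractible g W → Σ (Fin n) W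
  contractible-inhabited (k1 _ v wv _) = v , wv
  contractible-inhabited (step _ x wx _ _) = x , wx

  -- By induction, since a contractible sphere is non-empty and so ties the deleted vertex to the
  -- connected rest.
  contractible-connected : ∀ {W} → Contractible g W → ∀ {y z} → W y → W z → Path-in g W y z
  contractible-connected (k1 _ v wv only) {y} {z} wy wz with only y wy | only z wz
  ... | refl | refl = ε
  contractible-connected (step W x wx del sph) wy wz = Path-rev (from-x wy) ◅◅ from-x wz
    where
    from-x : ∀ {y} → W y → Path-in g W x y
    from-x {y} wy with y ≟ x | contractible-inhabited sph
    ... | yes refl | _ = ε
    ... | no y≢x | s , ws , xs with s ≟ x
    ... | yes refl = case trans (sym (g-irr s)) xs of λ ()
    ... | no s≢x = (wx , ws , xs) ◅ Star.map (λ ((p , _) , (q , _) , r) → p , q , r)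
                     (contractible-connected del (ws , s≢x) (wy , y≢x))

  -- The cocycle lives on all of `g` and only its potential is confined to `W`, so one `φ` serves
  -- every stage of a contraction.
  ExactOn : VSet n → Set
  ExactOn W = ∀ φ → Flat g φ →
    Σ (Fin n → Bool) λ f → ∀ i j → W i → W j → g i j ≡ true → φ i j ≡ f i xor f j

  -- The potential at the apex must be `f y xor φ y x` for every `y` in the base, and the cocycle
  -- condition makes this constant along paths of the base. As the base is asked to be connected
  -- rather than contractible, the lemma also covers the last vertex of a 2-sphere, whose link is a
  -- cycle.
  cone-exact : ∀ {W} x s → Sphere g W x s →
    (∀ {y z} → Sphere g W x y → Sphere g W x z → Path-in g (Sphere g W x) y z) →
    ExactOn (Delete W x) → ExactOn W
  cone-exact {W} x s xs path exact φ φ-flat@(φ-sym , φ-tri) = f′ , f′-exact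
    where
    f = proj₁ (exact φ φ-flat)
    f-exact = proj₂ (exact φ φ-flat)
    c = f s xor φ s x

    sphere≢x : ∀ {y} → g x y ≡ true → y ≢ x
    sphere≢x {y} e refl = case trans (sym (g-irr y)) e of λ ()

    along : ∀ {y z} → Path-in g (Sphere g W x) y z → f y xor φ y x ≡ f z xor φ z x
    along ε = refl
    along {y} (_◅_ {j = z} ((wy , xy) , (wz , xz) , yz) p) = trans step-eq (along p)
      where
      open ≡-Reasoning
      step-eq : f y xor φ y x ≡ f z xor φ z x
      step-eq = begin
        f y xor φ y x                     ≡⟨ cong (f y xor_) (φ-tri y z x yz (trans (g-sym z x) xz) (trans (g-sym y x) xy)) ⟩
        f y xor (φ y z xor φ z x)         ≡⟨ cong (λ b → f y xor (b xor φ z x)) (f-exact y z (wy , sphere≢x xy) (wz , sphere≢x xz) yz) ⟩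
        f y xor ((f y xor f z) xor φ z x) ≡⟨ xor-assoc (f y) _ _ ⟨
        (f y xor (f y xor f z)) xor φ z x ≡⟨ cong (_xor φ z x) (xor-move (f y) refl) ⟨
        f z xor φ z x                     ∎

    f′ : Fin n → Bool
    f′ i = if i == x then c else f i

    f′-x : f′ x ≡ c
    f′-x rewrite ==-refl x = refl

    f′-≢ : ∀ {i} → i ≢ x → f′ i ≡ f i
    f′-≢ i≢x rewrite ==-≢ i≢x = refl

    spoke : ∀ {y} → W y → g x y ≡ true → φ y x ≡ f′ y xor f′ x
    spoke {y} wy xy = begin
      φ y x                      ≡⟨ xor-move (f y) refl ⟩
      f y xor (f y xor φ y x)    ≡⟨ cong (f y xor_) (along (path (wy , xy) xs)) ⟩
      f y xor c                  ≡⟨ cong₂ _xor_ (f′-≢ (sphere≢x xy)) f′-x ⟨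
      f′ y xor f′ x              ∎
      where open ≡-Reasoning

    f′-exact : ∀ i j → W i → W j → g i j ≡ true → φ i j ≡ f′ i xor f′ j
    f′-exact i j wi wj ij = cases (i ≟ x) (j ≟ x)
      where
      cases : Dec (i ≡ x) → Dec (j ≡ x) → φ i j ≡ f′ i xor f′ j
      cases (yes refl) _ = trans (φ-sym i j ij) (trans (spoke wj ij) (xor-comm (f′ j) (f′ i)))
      cases (no i≢x) (yes refl) = spoke wi (trans (g-sym j i) ij)
      cases (no i≢x) (no j≢x) =
        trans (f-exact i j (wi , i≢x) (wj , j≢x) ij) (sym (cong₂ _xor_ (f′-≢ i≢x) (f′-≢ j≢x)))

  contractible-exact : ∀ {W} → Contractible g W → ExactOn W
  contractible-exact (k1 _ v wv only) φ φ-flat = (λ _ → false) , λ i j wi wj ij →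
    case trans (sym (g-irr v)) (subst₂ (λ i j → g i j ≡ true) (only i wi) (only j wj) ij) of λ ()
  contractible-exact (step W x wx del sph) =
    cone-exact x _ (proj₂ (contractible-inhabited sph)) (contractible-connected sph) (contractible-exact del)

-- 2-spheres are surfaces

module _ {n} {h : Adj n} (sphere : TwoSphere h) where
  private
    simple = proj₁ sphere
    h-sym = proj₁ simple
    h-irr = proj₂ simple
    links = proj₁ (proj₂ sphere)

  module SphereLink (x : Fin n) where
    m = proj₁ (links x)
    4≤m = proj₁ (proj₂ (links x))
    iso = proj₂ (proj₂ (proj₂ (links x)))
    v = proj₁ iso
    v-inj = proj₁ (proj₂ iso)
    v-mem = proj₁ (proj₂ (proj₂ iso))
    v-onto = proj₁ (proj₂ (proj₂ (proj₂ iso)))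
    v-adj = proj₂ (proj₂ (proj₂ (proj₂ iso)))

    3≤m = ℕ.<⇒≤ 4≤m
    2≤m = ℕ.<⇒≤ 3≤m

    index : ∀ {y} → h x y ≡ true → Σ (Fin m) λ i → v i ≡ y
    index {y} xy = v-onto y (_ , xy)

    to-h : ∀ {i j} → CycAdj m i j → h (v i) (v j) ≡ true
    to-h {i} {j} = Equivalence.from (v-adj i j)

    from-h : ∀ {i j} → h (v i) (v j) ≡ true → CycAdj m i j
    from-h {i} {j} = Equivalence.to (v-adj i j)

    CycAdj-irr : ∀ {i j} → CycAdj m i j → i ≢ j
    CycAdj-irr (inj₁ p) refl = Succ-irr 2≤m p
    CycAdj-irr (inj₂ p) refl = Succ-irr 2≤m p

    link-two : ∀ {y} → h x y ≡ true → Two (Common h x y)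
    link-two xy with index xy
    ... | i , refl = v s , v p , s≢p ∘ v-inj ,
        (proj₂ (v-mem s) , to-h (inj₁ i→s)) , (proj₂ (v-mem p) , to-h (inj₂ p→i)) , only
      where
      s = proj₁ (next i)
      i→s = proj₂ (next i)
      p = proj₁ (prev i)
      p→i = proj₂ (prev i)

      s≢p : s ≢ p
      s≢p e = no-2-cycle 3≤m i→s (subst (λ j → Succ m j i) (sym e) p→i)

      only : ∀ z → Common h x (v i) z → z ≡ v s ⊎ z ≡ v p
      only z (xz , iz) with index xz
      ... | j , refl with from-h iz
      ... | inj₁ i→j = inj₁ (cong v (Succ-unique i→j i→s))
      ... | inj₂ j→i = inj₂ (cong v (Pred-unique j→i p→i))

    triangle-free : ∀ {i j k} → CycAdj m i j → CycAdj m j k → CycAdj m i k → ⊥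
    triangle-free (inj₁ ij) jk (inj₁ ik) = CycAdj-irr jk (Succ-unique ij ik)
    triangle-free (inj₂ ji) jk (inj₂ ki) = CycAdj-irr jk (Pred-unique ji ki)
    triangle-free (inj₁ ij) (inj₁ jk) (inj₂ ki) = no-3-cycle 4≤m ij jk ki
    triangle-free ij@(inj₁ i→j) (inj₂ kj) ik@(inj₂ ki) = CycAdj-irr {_} {_} (ij) (Succ-unique ki kj)
    triangle-free (inj₂ ji) (inj₂ kj) (inj₁ ik) = no-3-cycle 4≤m ik kj ji
    triangle-free ij@(inj₂ _) (inj₁ jk) (inj₁ ik) = CycAdj-irr ij (Pred-unique ik jk)

    link-connected : ∀ {y z} → h x y ≡ true → h x z ≡ true → Star (Link h x) y z
    link-connected xy xz with index xy | index xz
    ... | i , refl | j , refl =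
      gmap v (λ {i} {j} e → proj₂ (v-mem i) , proj₂ (v-mem j) , to-h e) (cycle-connected i j)

  sphere-surface : Surface h
  sphere-surface = record
    { symm = h-sym
    ; irr  = λ i e → case trans (sym (h-irr i)) e of λ ()
    ; two  = λ {p} pq → SphereLink.link-two p pq
    ; noK4 = λ {i} ij ik il jk jl kl → noK4 i ij ik il jk jl kl
    ; conn = λ v vy vz → SphereLink.link-connected v vy vz
    ; H¹≡0 = λ φ φ-flat → let f , f-exact = exact φ φ-flat in f , λ i j → f-exact i j _ _
    }
    where
    noK4 : ∀ i {j k l} → h i j ≡ true → h i k ≡ true → h i l ≡ true →
           h j k ≡ true → h j l ≡ true → h k l ≡ true → ⊥
    noK4 i ij ik il jk jl kl
      with SphereLink.index i ij | SphereLink.index i ik | SphereLink.index i il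
    ... | _ , refl | _ , refl | _ , refl =
      SphereLink.triangle-free i (SphereLink.from-h i jk) (SphereLink.from-h i kl) (SphereLink.from-h i jl)

    x = proj₁ (proj₂ (proj₂ sphere))

    exact : ExactOn simple Full
    exact = cone-exact simple x (SphereLink.v x i₀) (SphereLink.v-mem x i₀)
      (λ (_ , xy) (_ , xz) → Star.map (λ (p , q , r) → (_ , p) , (_ , q) , r) (SphereLink.link-connected x xy xz))
      (contractible-exact simple (proj₂ (proj₂ (proj₂ sphere))))
      where
      i₀ = fromℕ< (ℕ.<-≤-trans (s≤s z≤n) (SphereLink.4≤m x))

-- The link of a vertex minus a point is a path

module LinkWalk {n} {h : Adj n} (S : Surface h) {v x : Fin n} (vx : h v x ≡ true) where
  open Surface S

  -- An oriented edge of the link of `v`. The walk has to remember the vertex it comes from in order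
  -- to know which neighbour is ahead.
  record Dart : Set where
    constructor dart
    field
      p q : Fin n
      vp  : h v p ≡ true
      vq  : h v q ≡ true
      pq  : h p q ≡ true
  open Dart

  forth : (d : Dart) → Σ (Fin n) λ r → p d ≢ r × Common h v (q d) r ×
          (∀ z → Common h v (q d) z → z ≡ p d ⊎ z ≡ r)
  forth d = Two-other (two (vq d)) (vp d , flip (pq d))

  advance : Dart → Dart
  advance d = dart (q d) r (vq d) (proj₁ c) (proj₂ c)
    where
    r = proj₁ (forth d)
    c = proj₁ (proj₂ (proj₂ (forth d)))

  walk : ℕ → Dart
  walk zero = dart x (proj₁ t) vx (proj₁ c) (proj₂ c)
    where
    t = two vx
    c = proj₁ (proj₂ (proj₂ (proj₂ t)))
  walk (suc k) = advance (walk k)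

  s : ℕ → Fin n
  s k = p (walk k)

  s-adj : ∀ k → h (s k) (s (suc k)) ≡ true
  s-adj k = pq (walk k)

  s-turn : ∀ k → s k ≢ s (suc (suc k))
  s-turn k = proj₁ (proj₂ (forth (walk k)))

  s-nbrs : ∀ k {z} → h v z ≡ true → h (s (suc k)) z ≡ true → z ≡ s k ⊎ z ≡ s (suc (suc k))
  s-nbrs k vz kz = proj₂ (proj₂ (proj₂ (forth (walk k)))) _ (vz , kz)

  DistinctBelow : ℕ → Set
  DistinctBelow m = ∀ i j → i < j → j < m → s i ≢ s j

  Repeats : ℕ → Set
  Repeats m = Σ ℕ λ i → i < m × s i ≡ s m

  -- The search ends because `suc n` terms of a sequence in `Fin n` cannot be distinct; taking the
  -- first repetition keeps all earlier terms distinct.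
  first-repeat : ∀ fuel m → fuel + m ≡ suc n → DistinctBelow m →
                 Σ ℕ λ m → DistinctBelow m × Repeats m
  first-repeat zero _ refl distinct-below with pigeonhole (ℕ.n<1+n n) (s ∘ toℕ)
  ... | i , j , i<j , e = ⊥-elim (distinct-below (toℕ i) (toℕ j) i<j (toℕ<n j) e)
  first-repeat (suc fuel) m e distinct-below with ℕ.anyUpTo? (λ i → s i ≟ s m) m
  ... | yes r = m , distinct-below , r
  ... | no ¬r = first-repeat fuel (suc m) (trans (ℕ.+-suc fuel m) e) distinct-below′
    where
    distinct-below′ : DistinctBelow (suc m)
    distinct-below′ i j i<j (s≤s j≤m) eq with ℕ.m≤n⇒m<n∨m≡n j≤m
    ... | inj₁ j<m = distinct-below i j i<j j<m eq
    ... | inj₂ refl = ¬r (i , i<j , eq)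

  -- If the walk first returned to a later vertex, the vertex visited just before the return would
  -- be one of the two link neighbours of that vertex, which were visited already. This is an
  -- earlier repetition, or else a step that stays in place or turns back.
  repeats-at-0 : ∀ {m} → DistinctBelow m → Repeats m → s 0 ≡ s m
  repeats-at-0 db (zero , _ , e) = e
  repeats-at-0 {suc m} db (suc i , s≤s i<m , e)
    with s-nbrs i (vp (walk m)) (subst (λ y → h y (s m) ≡ true) (sym e) (flip (s-adj m)))
  ... | inj₁ back = ⊥-elim (db i m i<m (ℕ.n<1+n m) (sym back))
  ... | inj₂ ahead with ℕ.<-cmp (suc (suc i)) m
  ... | tri< lt _ _ = ⊥-elim (db (suc (suc i)) m lt (ℕ.n<1+n m) (sym ahead))
  ... | tri≈ _ refl _ = ⊥-elim (s-turn (suc i) e)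
  ... | tri> _ _ (s≤s m≤1+i) with ℕ.≤-antisym m≤1+i i<m
  ... | refl = ⊥-elim (distinct (s-adj (suc i)) e)

  private
    found : Σ ℕ λ m → DistinctBelow m × Repeats m
    found = first-repeat (suc n) 0 (ℕ.+-identityʳ (suc n)) λ _ _ _ ()

  -- The index is shifted so that `m` is the length of the circle without its starting vertex `x`:
  -- the vertices `s 1` to `s m` form the path. Lengths 1 and 2 are excluded by irreflexivity and by
  -- `s-turn`.
  circle : Σ ℕ λ m → 1 < m × DistinctBelow (suc m) × s 0 ≡ s (suc m)
  circle with found
  ... | m , db , r with m | db | repeats-at-0 db r | r
  ... | zero | _ | _ | _ , () , _
  ... | suc zero | _ | e | _ = ⊥-elim (distinct (s-adj 0) e)
  ... | suc (suc zero) | _ | e | _ = ⊥-elim (s-turn 0 e)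
  ... | suc (suc (suc m)) | db | e | _ = suc (suc m) , s≤s (s≤s z≤n) , db , e

  module Closed {m : ℕ} (1<m : 1 < m) (db : DistinctBelow (suc m)) (closed : s 0 ≡ s (suc m)) where

    s-inj : ∀ {i j} → i ≤ m → j ≤ m → s i ≡ s j → i ≡ j
    s-inj {i} {j} i≤m j≤m e with ℕ.<-cmp i j
    ... | tri< lt _ _ = ⊥-elim (db i j lt (s≤s j≤m) e)
    ... | tri≈ _ eq _ = eq
    ... | tri> _ _ gt = ⊥-elim (db j i gt (s≤s i≤m) (sym e))

    s-adj⇒ : ∀ {i j} → i < m → j < m → h (s (suc i)) (s (suc j)) ≡ true → suc i ≡ j ⊎ suc j ≡ i
    s-adj⇒ {i} {j} i<m j<m e with s-nbrs i (vp (walk (suc j))) e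
    ... | inj₁ back = inj₂ (s-inj j<m (ℕ.<⇒≤ i<m) back)
    ... | inj₂ ahead with ℕ.m≤n⇒m<n∨m≡n i<m
    ... | inj₁ 1+i<m = inj₁ (ℕ.suc-injective (s-inj 1+i<m j<m (sym ahead)))
    ... | inj₂ 1+i≡m = case s-inj j<m z≤n (trans ahead (trans (cong (s ∘ suc) 1+i≡m) (sym closed))) of λ ()

    Visited : Fin n → Set
    Visited z = Σ ℕ λ k → k ≤ m × s k ≡ z

    -- The two neighbours of a visited vertex are its predecessor and successor on the walk. With
    -- connectedness of the link, this rules out a second component.
    visit-step : ∀ {y z} → Link h v y z → Visited y → Visited z
    visit-step (vy , vz , yz) (suc k , k<m , refl) with s-nbrs k vz yz
    ... | inj₁ e = k , ℕ.<⇒≤ k<m , sym e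
    ... | inj₂ e with ℕ.m≤n⇒m<n∨m≡n k<m
    ... | inj₁ lt = suc (suc k) , lt , sym e
    ... | inj₂ 1+k≡m = 0 , z≤n , trans (trans closed (cong (s ∘ suc) (sym 1+k≡m))) (sym e)
    visit-step {z = z} (vy , vz , yz) (zero , _ , refl)
      with Two-other (two vy) {s 1} (vp (walk 1) , s-adj 0)
    ... | r , _ , _ , only with only z (vz , yz)
    ... | inj₁ e = 1 , ℕ.<⇒≤ 1<m , sym e
    -- The walk has no predecessor of `s 0`; since it closes up, `s m` plays this role, and it
    -- differs from `s 1` because `1 < m`.
    ... | inj₂ refl with only (s m) (vp (walk m) , subst (λ y → h y (s m) ≡ true) (sym closed) (flip (s-adj m)))
    ... | inj₁ e = ⊥-elim (ℕ.<⇒≢ 1<m (sym (s-inj ℕ.≤-refl (ℕ.<⇒≤ 1<m) e)))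
    ... | inj₂ e = m , ℕ.≤-refl , e

    visit-star : ∀ {y z} → Star (Link h v) y z → Visited y → Visited z
    visit-star ε vis = vis
    visit-star (l ◅ p) vis = visit-star p (visit-step l vis)

    all-visited : ∀ {z} → h v z ≡ true → Visited z
    all-visited vz = visit-star (conn v vx vz) (0 , z≤n , refl)

-- Balls with their boundary

-- The Boolean `∂` is a decidable form of `Boundary g`, with agreement shown by `∂⇒boundary` and
-- `boundary⇒∂`. A refinement merely extends it by `false`.
record Ball {n} (g : Adj n) (∂ : Fin n → Bool) : Set where
  field
    h       : Adj (suc n)
    x       : Fin (suc n)
    surface : Surface h
    g≡      : ∀ i j → g i j ≡ h (punchIn x i) (punchIn x j)
    ∂≡      : ∀ i → ∂ i ≡ h x (punchIn x i)
  open Surface surface public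

  ι : Fin n → Fin (suc n)
  ι = punchIn x

  ι-inj : ∀ {i j} → ι i ≡ ι j → i ≡ j
  ι-inj = punchIn-injective x _ _

  to-g : ∀ {i j} → h (ι i) (ι j) ≡ true → g i j ≡ true
  to-g = trans (g≡ _ _)

  from-g : ∀ {i j} → g i j ≡ true → h (ι i) (ι j) ≡ true
  from-g = trans (sym (g≡ _ _))

  g-flip : ∀ {i j} → g i j ≡ true → g j i ≡ true
  g-flip = to-g ∘ flip ∘ from-g

  g-irr : ∀ i → g i i ≢ true
  g-irr i = irr (ι i) ∘ from-g

  x≢ι : ∀ {i} → x ≢ ι i
  x≢ι e = punchInᵢ≢i x _ (sym e)

  old : ∀ {y} → x ≢ y → Σ (Fin n) λ i → ι i ≡ y
  old x≢y = punchOut x≢y , punchIn-punchOut x≢y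

  ∂⇒boundary : ∀ {v} → ∂ v ≡ true → Boundary g v
  ∂⇒boundary {v} ∂v = close (LinkWalk.circle surface (flip (trans (sym (∂≡ v)) ∂v)))
    where
    close : (Σ ℕ λ m → 1 < m × _ × _) → Boundary g v
    close (m , 1<m , db , closed) = m , ℕ.<⇒≤ 1<m , path , injective , (λ i → tt , member i) , onto ,
      λ i j → mk⇔ (to i j) (from i j)
      where
      open LinkWalk surface {ι v} {x} (flip (trans (sym (∂≡ v)) ∂v))
      open Closed 1<m db closed

      avoids : (i : Fin m) → x ≢ s (suc (toℕ i))
      avoids i e = case s-inj z≤n (toℕ<n i) e of λ ()

      path : Fin m → Fin n
      path i = proj₁ (old (avoids i))

      path-≡ : ∀ i → ι (path i) ≡ s (suc (toℕ i))
      path-≡ i = proj₂ (old (avoids i))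

      injective : ∀ {i j} → path i ≡ path j → i ≡ j
      injective {i} {j} e = toℕ-injective (ℕ.suc-injective (s-inj (toℕ<n i) (toℕ<n j)
        (trans (sym (path-≡ i)) (trans (cong ι e) (path-≡ j)))))

      member : ∀ i → g v (path i) ≡ true
      member i = to-g (trans (cong (h (ι v)) (path-≡ i)) (Dart.vp (walk (suc (toℕ i)))))

      onto : ∀ w → Sphere g Full v w → Σ (Fin m) λ i → path i ≡ w
      onto w (_ , vw) with all-visited (from-g vw)
      ... | zero , _ , e = ⊥-elim (x≢ι e)
      ... | suc k , k<m , e = fromℕ< k<m ,
        ι-inj (trans (path-≡ (fromℕ< k<m)) (trans (cong (s ∘ suc) (toℕ-fromℕ< k<m)) e))

      to : ∀ i j → g (path i) (path j) ≡ true → PathAdj m i j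
      to i j e = s-adj⇒ (toℕ<n i) (toℕ<n j)
        (subst₂ (λ y z → h y z ≡ true) (path-≡ i) (path-≡ j) (from-g e))

      from : ∀ i j → PathAdj m i j → g (path i) (path j) ≡ true
      from i j (inj₁ e) = to-g (subst₂ (λ y z → h y z ≡ true) (sym (path-≡ i)) (sym (path-≡ j))
        (subst (λ k → h (s (suc (toℕ i))) (s (suc k)) ≡ true) e (s-adj (suc (toℕ i)))))
      from i j (inj₂ e) = g-flip (from j i (inj₁ e))

  -- Neither of the two triangles in the sphere has `x` as its third vertex, since `x` is adjacent
  -- to boundary vertices only.
  two-in-g : ∀ {v w} → g v w ≡ true → ¬ (∂ v ≡ true × ∂ w ≡ true) → Two (Common g v w)
  two-in-g {v} {w} vw interior with two (from-g vw)
  ... | y , z , y≢z , cy , cz , only with old (avoid cy) | old (avoid cz)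
    where
    avoid : ∀ {y} → Common h (ι v) (ι w) y → x ≢ y
    avoid (vx , wx) refl = interior (trans (∂≡ v) (flip vx) , trans (∂≡ w) (flip wx))
  ... | i , refl | j , refl =
    i , j , (λ e → y≢z (cong ι e)) , (to-g (proj₁ cy) , to-g (proj₂ cy)) , (to-g (proj₁ cz) , to-g (proj₂ cz)) ,
    λ k (vk , wk) → Sum.map ι-inj ι-inj (only (ι k) (from-g vk , from-g wk))

  -- Off `∂` every vertex of the link has two neighbours in it, but the first vertex of a path has
  -- at most one.
  boundary⇒∂ : ∀ {v} → Boundary g v → ∂ v ≡ true
  boundary⇒∂ {v} (suc m , _ , path , injective , member , onto , adj) with ∂ v in eq
  ... | true = refl
  ... | false with two-in-g (proj₂ (member zero)) (λ (e , _) → case trans (sym eq) e of λ ())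
  ... | y , z , y≢z , (vy , 0y) , (vz , 0z) , _ with onto y (_ , vy) | onto z (_ , vz)
  ... | i , refl | j , refl = ⊥-elim (y≢z (cong path (toℕ-injective (trans (second i 0y) (sym (second j 0z))))))
    where
    second : ∀ i → g (path zero) (path i) ≡ true → toℕ i ≡ 1
    second i e with Equivalence.to (adj zero i) e
    ... | inj₁ p = sym p

==-ι : ∀ {n} {g : Adj n} {∂} (B : Ball g ∂) i j → i == j ≡ Ball.ι B i == Ball.ι B j
==-ι B i j with i ≟ j | Ball.ι B i ≟ Ball.ι B j
... | yes _ | yes _ = refl
... | yes e | no ne = ⊥-elim (ne (cong (Ball.ι B) e))
... | no ne | yes e = ⊥-elim (ne (Ball.ι-inj B e))
... | no _ | no _ = refl

newAdj-pull : ∀ {n} {g : Adj n} {∂} (B : Ball g ∂) a b y →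
  newAdj g a b y ≡ newAdj (Ball.h B) (Ball.ι B a) (Ball.ι B b) (Ball.ι B y)
newAdj-pull B a b y =
  cong₂ _∨_ (==-ι B y a) (cong₂ _∨_ (==-ι B y b) (cong₂ _∧_ (Ball.g≡ B a y) (Ball.g≡ B b y)))

-- Refinement commutes with deleting `x`. The new vertex stays off the boundary: it would be
-- adjacent to `x` only if `x` were a common neighbour of `a` and `b`, which puts both of them on
-- the boundary.
refine-ball : ∀ {n} {g : Adj n} {∂} (B : Ball g ∂) {a b} → g a b ≡ true →
  ¬ (∂ a ≡ true × ∂ b ≡ true) → Ball (refine g a b) (false V.∷ ∂)
refine-ball {g = g} {∂} B {a} {b} ab interior = record
  { h = refine h (ι a) (ι b)
  ; x = suc x
  ; surface = refine-surface surface (from-g ab)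
  ; g≡ = g′≡
  ; ∂≡ = ∂′≡
  }
  where
  open Ball B

  g′≡ : ∀ i j → refine g a b i j ≡ refine h (ι a) (ι b) (punchIn (suc x) i) (punchIn (suc x) j)
  g′≡ zero    zero    = refl
  g′≡ zero    (suc j) = newAdj-pull B a b j
  g′≡ (suc i) zero    = newAdj-pull B a b i
  g′≡ (suc i) (suc j) = cong₂ (if_then false else_)
    (cong₂ _∨_ (cong₂ _∧_ (==-ι B i a) (==-ι B j b)) (cong₂ _∧_ (==-ι B i b) (==-ι B j a))) (g≡ i j)

  ∂′≡ : ∀ i → (false V.∷ ∂) i ≡ refine h (ι a) (ι b) (suc x) (punchIn (suc x) i)
  ∂′≡ zero with h (ι a) x in p | h (ι b) x in q
  ... | false | _ rewrite ==-≢ (x≢ι {a}) | ==-≢ (x≢ι {b}) = refl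
  ... | true | false rewrite ==-≢ (x≢ι {a}) | ==-≢ (x≢ι {b}) = refl
  ... | true | true = ⊥-elim (interior (trans (∂≡ a) (flip p) , trans (∂≡ b) (flip q)))
  ∂′≡ (suc i) rewrite ==-≢ (x≢ι {a}) | ==-≢ (x≢ι {b}) = ∂≡ i

-- Colourings

Colour : Set
Colour = Fin 3

avoid : (α β : Colour) → Σ Colour λ γ → γ ≢ α × γ ≢ β
avoid zero zero = suc zero , (λ ()) , (λ ())
avoid zero (suc zero) = suc (suc zero) , (λ ()) , (λ ())
avoid zero (suc (suc zero)) = suc zero , (λ ()) , (λ ())
avoid (suc zero) zero = suc (suc zero) , (λ ()) , (λ ())
avoid (suc zero) (suc _) = zero , (λ ()) , (λ ())
avoid (suc (suc zero)) zero = suc zero , (λ ()) , (λ ())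
avoid (suc (suc zero)) (suc _) = zero , (λ ()) , (λ ())

Mono : ∀ {n} → Adj n → (Fin n → Colour) → Fin n → Fin n → Set
Mono g f i j = g i j ≡ true × f i ≡ f j

-- `proper` guarantees that a monochromatic edge is interior and may be refined; `turn` yields even
-- degrees at the boundary.
record BoundaryColouring {n} (g : Adj n) (∂ : Fin n → Bool) (f : Fin n → Colour) : Set where
  field
    proper : ∀ {i j} → ∂ i ≡ true → ∂ j ≡ true → g i j ≡ true → f i ≢ f j
    turn   : ∀ {v i j} → ∂ v ≡ true → ∂ i ≡ true → ∂ j ≡ true →
             g v i ≡ true → g v j ≡ true → i ≢ j → f i ≢ f j

refine-colouring : ∀ {n} {g : Adj n} {∂ f} → BoundaryColouring g ∂ f → ∀ a b γ →
  BoundaryColouring (refine g a b) (false V.∷ ∂) (γ V.∷ f)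
refine-colouring {g = g} C a b γ = record
  { proper = λ { {suc i} {suc j} ∂i ∂j ij → proper ∂i ∂j (proj₁ (old-elim g a b i j ij)) }
  ; turn = λ { {suc v} {suc i} {suc j} ∂v ∂i ∂j vi vj i≢j →
      turn ∂v ∂i ∂j (proj₁ (old-elim g a b v i vi)) (proj₁ (old-elim g a b v j vj)) (i≢j ∘ cong suc) }
  }
  where open BoundaryColouring C

-- Refining monochromatic edges away

module _ {n} (g : Adj n) (f : Fin n → Colour) {a b : Fin n} {γ : Colour}
         (γ≢a : γ ≢ f a) (γ≢b : γ ≢ f b) where

  new-mono : ∀ y → newAdj g a b y ≡ true → γ ≡ f y → Common g a b y
  new-mono y ny e with new-elim g a b y ny
  ... | inj₁ (inj₁ refl) = ⊥-elim (γ≢a e)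
  ... | inj₁ (inj₂ refl) = ⊥-elim (γ≢b e)
  ... | inj₂ c = c

  old-mono : ∀ i j → Mono (refine g a b) (γ V.∷ f) (suc i) (suc j) → Mono g f i j × ¬ SameEdge a b i j
  old-mono i j (e , c) with old-elim g a b i j e
  ... | ij , ne = (ij , c) , ne

-- One or two refinements may be needed, so `prefix` stores them as a function that prepends them to
-- a later sequence. `mono` bounds the remaining monochromatic edges by the old ones other than the
-- treated edge, which makes the procedure terminate.
record Reduction {n} (g : Adj n) (f : Fin n → Colour) (a b : Fin n) : Set where
  field
    {n′}     : ℕ
    {g′}     : Adj n′
    {∂′}     : Fin n′ → Bool
    f′       : Fin n′ → Colour
    ball     : Ball g′ ∂′
    coloured : BoundaryColouring g′ ∂′ f′
    prefix   : ∀ {m} {H : Adj m} → Refines g′ H → Refines g H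
    embed    : Fin n → Fin n′
    mono     : ∀ i j → Mono g′ f′ i j → Σ (Fin n) λ i₀ → Σ (Fin n) λ j₀ →
               i ≡ embed i₀ × j ≡ embed j₀ × Mono g f i₀ j₀ × ¬ SameEdge a b i₀ j₀

interior-step : ∀ {n} {g : Adj n} {∂} → Ball g ∂ → ∀ {a b} → g a b ≡ true → ¬ (∂ a ≡ true × ∂ b ≡ true) →
  ∀ {m} {H : Adj m} → Refines (refine g a b) H → Refines g H
interior-step B {a} {b} ab interior = step _ _ a b ab
  λ (ba , bb) → interior (Ball.boundary⇒∂ B ba , Ball.boundary⇒∂ B bb)

module _ {n} {g : Adj n} {∂ f} (B : Ball g ∂) (C : BoundaryColouring g ∂ f) {a b : Fin n} (ab : Mono g f a b) where
  open Ball B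
  open BoundaryColouring C
  private
    g₁ = refine g a b

    interior : ¬ (∂ a ≡ true × ∂ b ≡ true)
    interior (∂a , ∂b) = proper ∂a ∂b (proj₁ ab) (proj₂ ab)

    B₁ = refine-ball B (proj₁ ab) interior

  reduce-once : ∀ γ → γ ≢ f a → (∀ z → Common g a b z → γ ≢ f z) → Reduction g f a b
  reduce-once γ γ≢a γ≢z = record
    { f′ = γ V.∷ f
    ; ball = B₁
    ; coloured = refine-colouring C a b γ
    ; prefix = interior-step B (proj₁ ab) interior
    ; embed = suc
    ; mono = mono
    }
    where
    γ≢b : γ ≢ f b
    γ≢b e = γ≢a (trans e (sym (proj₂ ab)))

    mono : ∀ i j → Mono g₁ (γ V.∷ f) i j → Σ (Fin n) λ i₀ → Σ (Fin n) λ j₀ →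
           i ≡ suc i₀ × j ≡ suc j₀ × Mono g f i₀ j₀ × ¬ SameEdge a b i₀ j₀
    mono zero (suc j) (e , c) = ⊥-elim (γ≢z j (new-mono g f γ≢a γ≢b j e c) c)
    mono (suc i) zero (e , c) = ⊥-elim (γ≢z i (new-mono g f γ≢a γ≢b i e (sym c)) (sym c))
    mono (suc i) (suc j) e with old-mono g f γ≢a γ≢b i j e
    ... | m , ne = i , j , refl , refl , m , ne

  -- The new vertex gets the colour of u; refining the monochromatic edge to u as well repairs this,
  -- since the two vertices opposite to that edge are a and b, which have the same colour.
  reduce-twice : ∀ u → Common g a b u → f u ≢ f a →
                 (∀ z → Common g a b z → f u ≡ f z → z ≡ u) → Reduction g f a b
  reduce-twice u (au , bu) u≢a only = record
    { f′ = δ V.∷ f₁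
    ; ball = refine-ball B₁ {zero} {suc u} new-u λ ()
    ; coloured = refine-colouring (refine-colouring C a b (f u)) zero (suc u) δ
    ; prefix = interior-step B (proj₁ ab) interior ∘ interior-step B₁ {zero} {suc u} new-u λ ()
    ; embed = λ i → suc (suc i)
    ; mono = mono
    }
    where
    f₁ = f u V.∷ f

    u≢b : f u ≢ f b
    u≢b e = u≢a (trans e (sym (proj₂ ab)))

    δ = proj₁ (avoid (f a) (f u))
    δ≢a = proj₁ (proj₂ (avoid (f a) (f u)))
    δ≢u = proj₂ (proj₂ (avoid (f a) (f u)))

    new-u : g₁ zero (suc u) ≡ true
    new-u = new-common g (au , bu)

    -- A neighbour of the new vertex other than `a` and `b` is adjacent to both; if it were adjacent
    -- to `u` as well, `noK4` would fail.
    ends : ∀ z → Common g₁ zero (suc u) z → f₁ z ≡ f a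
    ends (suc z) (nz , uz) with new-elim g a b z nz
    ... | inj₁ (inj₁ refl) = refl
    ... | inj₁ (inj₂ refl) = sym (proj₂ ab)
    ... | inj₂ (az , bz) = ⊥-elim (noK4 (from-g (proj₁ ab)) (from-g au) (from-g az) (from-g bu) (from-g bz)
                                        (from-g (proj₁ (old-elim g a b u z uz))))

    refined : ∀ y → newAdj g₁ zero (suc u) y ≡ true → δ ≡ f₁ y → ⊥
    refined y ny e = δ≢a (trans e (ends y (new-mono g₁ f₁ {zero} {suc u} δ≢u δ≢u y ny e)))

    mono : ∀ i j → Mono (refine g₁ zero (suc u)) (δ V.∷ f₁) i j → Σ (Fin n) λ i₀ → Σ (Fin n) λ j₀ →
           i ≡ suc (suc i₀) × j ≡ suc (suc j₀) × Mono g f i₀ j₀ × ¬ SameEdge a b i₀ j₀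
    mono zero (suc j) (e , c) = ⊥-elim (refined j e c)
    mono (suc i) zero (e , c) = ⊥-elim (refined i e (sym c))
    mono (suc i) (suc j) e with old-mono g₁ f₁ {zero} {suc u} δ≢u δ≢u i j e
    mono (suc zero) (suc (suc j)) _ | (e , c) , ne
      with only j (new-mono g f u≢a u≢b j e c) c
    ... | refl = ⊥-elim (ne (inj₁ (refl , refl)))
    mono (suc (suc i)) (suc zero) _ | (e , c) , ne
      with only i (new-mono g f u≢a u≢b i e (sym c)) (sym c)
    ... | refl = ⊥-elim (ne (inj₂ (refl , refl)))
    mono (suc (suc i)) (suc (suc j)) _ | e , _ with old-mono g f u≢a u≢b i j e
    ... | m , ne = i , j , refl , refl , m , ne

  reduce : Reduction g f a b
  reduce with two-in-g (proj₁ ab) interior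
  ... | u , w , u≢w , cu , cw , only = by-colour (f u ≟ f a) (f w ≟ f a) (f u ≟ f w)
    where
    pick : ∀ γ → γ ≢ f a → γ ≢ f u → γ ≢ f w → Reduction g f a b
    pick γ γ≢a γ≢u γ≢w = reduce-once γ γ≢a λ z cz e → case only z cz of λ
      { (inj₁ refl) → γ≢u e ; (inj₂ refl) → γ≢w e }

    -- The new vertex must avoid the colours of `a`, `u` and `w`, which is possible unless these
    -- three are pairwise different.
    by-colour : Dec (f u ≡ f a) → Dec (f w ≡ f a) → Dec (f u ≡ f w) → Reduction g f a b
    by-colour (yes p) _ _ with avoid (f a) (f w)
    ... | γ , γ≢a , γ≢w = pick γ γ≢a (λ e → γ≢a (trans e p)) γ≢w
    by-colour (no _) (yes p) _ with avoid (f a) (f u)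
    ... | γ , γ≢a , γ≢u = pick γ γ≢a γ≢u (λ e → γ≢a (trans e p))
    by-colour (no _) (no _) (yes p) with avoid (f a) (f u)
    ... | γ , γ≢a , γ≢u = pick γ γ≢a γ≢u (λ e → γ≢u (trans e (sym p)))
    by-colour (no u≢a) (no _) (no u≢w′) = reduce-twice u cu u≢a λ z cz e → case only z cz of λ
      { (inj₁ refl) → refl ; (inj₂ refl) → ⊥-elim (u≢w′ e) }

record ProperRefinement {n} (g : Adj n) : Set where
  field
    {n′}     : ℕ
    {g′}     : Adj n′
    {∂′}     : Fin n′ → Bool
    f′       : Fin n′ → Colour
    ball     : Ball g′ ∂′
    coloured : BoundaryColouring g′ ∂′ f′
    refines  : Refines g g′
    proper   : ∀ i j → ¬ Mono g′ f′ i j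

-- Monochromatic edges are only ever destroyed, so it is enough to go through a list containing
-- the ones present at the start.
properly-refine : ∀ {n₀} (es : List (Fin n₀ × Fin n₀)) {n} {g : Adj n} {∂ f} →
  Ball g ∂ → BoundaryColouring g ∂ f → (emb : Fin n₀ → Fin n) →
  (∀ i j → Mono g f i j → Σ (Fin n₀) λ i₀ → Σ (Fin n₀) λ j₀ → i ≡ emb i₀ × j ≡ emb j₀ × (i₀ , j₀) ∈ es) →
  ProperRefinement g
properly-refine [] B C emb listed = record
  { ball = B ; coloured = C ; refines = done _
  ; proper = λ i j m → case listed i j m of λ { (_ , _ , _ , _ , ()) } }
properly-refine ((p , q) ∷ es) {g = g} {f = f} B C emb listed
  with (g (emb p) (emb q) ≟ᵇ true) ×-dec (f (emb p) ≟ f (emb q))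
... | no ¬m = properly-refine es B C emb λ i j m → case listed i j m of λ
  { (_ , _ , refl , refl , here refl) → ⊥-elim (¬m m)
  ; (i₀ , j₀ , ei , ej , there l) → i₀ , j₀ , ei , ej , l }
... | yes m = record { ProperRefinement rest ; refines = prefix (ProperRefinement.refines rest) }
  where
  open Reduction (reduce B C m)
  rest = properly-refine es ball coloured (embed ∘ emb) λ i j m′ → case mono i j m′ of λ
    { (i₁ , j₁ , refl , refl , m₁ , ne) → case listed i₁ j₁ m₁ of λ
      { (_ , _ , refl , refl , here refl) → ⊥-elim (ne (inj₁ (refl , refl)))
      ; (i₀ , j₀ , refl , refl , there l) → i₀ , j₀ , refl , refl , l } }

-- Proper colourings force even degrees

Palette : Colour → Colour → Colour → Set
Palette α c d = c ≢ d × c ≢ α × d ≢ α × (∀ δ → δ ≢ α → δ ≡ c ⊎ δ ≡ d)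

Palette-swap : ∀ {α c d} → Palette α c d → Palette α d c
Palette-swap (c≢d , c≢α , d≢α , all) = c≢d ∘ sym , d≢α , c≢α , λ δ → Sum.swap ∘ all δ

palette : ∀ α → Σ Colour λ c → Σ Colour λ d → Palette α c d
palette zero = suc zero , suc (suc zero) , (λ ()) , (λ ()) , (λ ()) , λ
  { zero n → ⊥-elim (n refl) ; (suc zero) _ → inj₁ refl ; (suc (suc zero)) _ → inj₂ refl }
palette (suc zero) = zero , suc (suc zero) , (λ ()) , (λ ()) , (λ ()) , λ
  { zero _ → inj₁ refl ; (suc zero) n → ⊥-elim (n refl) ; (suc (suc zero)) _ → inj₂ refl }
palette (suc (suc zero)) = zero , suc zero , (λ ()) , (λ ()) , (λ ()) , λ
  { zero _ → inj₁ refl ; (suc zero) _ → inj₂ refl ; (suc (suc zero)) n → ⊥-elim (n refl) }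

𝟙-false : ∀ {b} → b ≢ true → 𝟙 b ≡ 0
𝟙-false {true} ne = ⊥-elim (ne refl)
𝟙-false {false} ne = refl

𝟙-true : ∀ {b} → b ≡ true → 𝟙 b ≡ 1
𝟙-true refl = refl

≢true : ∀ {b} → b ≢ true → b ≡ false
≢true {true} ne = ⊥-elim (ne refl)
≢true {false} ne = refl

count-pair : ∀ {n} (p : Fin n → Bool) → Two (λ i → p i ≡ true) → count p ≡ 2
count-pair p (u , w , u≢w , pu , pw , only) =
  trans (sum-pair _ u w u≢w λ k k≢u k≢w → 𝟙-false λ pk → Sum.[ k≢u , k≢w ] (only k pk))
        (cong₂ _+_ (𝟙-true pu) (𝟙-true pw))

count-single : ∀ {n} (p : Fin n → Bool) u → p u ≡ true → (∀ i → p i ≡ true → i ≡ u) → count p ≡ 1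
count-single p u pu only = trans (sum-single _ u λ k k≢u → 𝟙-false (k≢u ∘ only k)) (𝟙-true pu)

count-none : ∀ {n} (p : Fin n → Bool) → (∀ i → p i ≢ true) → count p ≡ 0
count-none p none = sum-zero _ λ i → 𝟙-false (none i)

-- Instead of following the alternation around the link, its edges between the colours `c` and `d`
-- are counted from either side. Increased by 1 if `v` is on the boundary, their number is twice the
-- number of neighbours of colour `c`, and equally twice that of colour `d`. So the two classes have
-- equal size, and the degree is twice that size.
module Evenness {n} {g : Adj n} {∂ f} (B : Ball g ∂) (C : BoundaryColouring g ∂ f)
                (proper : ∀ i j → ¬ Mono g f i j) (v : Fin n) where
  open Ball B
  open BoundaryColouring C using (turn)

  nbr : Colour → Fin n → Bool
  nbr c j = g v j ∧ (f j == c)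

  nbr-elim : ∀ {c j} → nbr c j ≡ true → g v j ≡ true × f j ≡ c
  nbr-elim {c} {j} e = proj₁ (∧-elim e) , ==-sound (proj₂ (∧-elim {g v j} e))

  nbr-intro : ∀ {c j} → g v j ≡ true → f j ≡ c → nbr c j ≡ true
  nbr-intro {c} e refl = ∧-intro e (==-refl c)

  edges : Colour → Colour → Fin n → Fin n → Bool
  edges c d j k = nbr c j ∧ (nbr d k ∧ g j k)

  ends : Colour → Fin n → Bool
  ends c j = nbr c j ∧ (∂ v ∧ ∂ j)

  -- In the sphere, the edge from `v` to `j` lies in two triangles. Their third vertices have colour
  -- `d`, except that one of them is the uncoloured `x` when `v` and `j` are both on the boundary;
  -- `ends` makes up for it.
  row : ∀ {c d} → Palette (f v) c d → ∀ j → count (edges c d j) + 𝟙 (ends c j) ≡ 2 * 𝟙 (nbr c j)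
  row {c} {d} (c≢d , _ , _ , all) j with nbr c j in e
  ... | false = cong (_+ 0) (count-none {n} (λ _ → false) λ _ ())
  ... | true with nbr-elim {c} {j} e
  ... | vj , refl = by-boundary (∂ v ≟ᵇ true) (∂ j ≟ᵇ true)
    where
    edge-elim : ∀ k → nbr d k ∧ g j k ≡ true → Common g v j k
    edge-elim k e = proj₁ (nbr-elim {d} (proj₁ (∧-elim e))) , proj₂ (∧-elim {nbr d k} e)

    edge-intro : ∀ k → Common g v j k → nbr d k ∧ g j k ≡ true
    edge-intro k (vk , jk) = ∧-intro (nbr-intro vk colour) jk
      where
      colour : f k ≡ d
      colour with all (f k) (λ e → proper v k (vk , sym e))
      ... | inj₁ e = ⊥-elim (proper j k (jk , sym e))
      ... | inj₂ e = e

    by-boundary : Dec (∂ v ≡ true) → Dec (∂ j ≡ true) →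
      count (λ k → nbr d k ∧ g j k) + 𝟙 (∂ v ∧ ∂ j) ≡ 2
    by-boundary (yes ∂v) (yes ∂j)
      with Two-other (two (from-g vj)) (flip (trans (sym (∂≡ v)) ∂v) , flip (trans (sym (∂≡ j)) ∂j))
    ... | r , x≢r , (vr , jr) , only with old x≢r
    ... | k , refl = cong₂ _+_
      (count-single (λ k → nbr d k ∧ g j k) k (edge-intro k (to-g vr , to-g jr)) λ l e →
        case only (ι l) (from-g (proj₁ (edge-elim l e)) , from-g (proj₂ (edge-elim l e))) of λ
          { (inj₁ l≡x) → ⊥-elim (x≢ι (sym l≡x)) ; (inj₂ e) → ι-inj e })
      (𝟙-true (∧-intro ∂v ∂j))
    by-boundary (no ¬∂v) _ rewrite ≢true ¬∂v =
      trans (ℕ.+-identityʳ _) (count-pair (λ k → nbr d k ∧ g j k)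
        (Two-cong (λ {k} → edge-intro k) (λ {k} → edge-elim k) (two-in-g vj λ (∂v , _) → ¬∂v ∂v)))
    by-boundary _ (no ¬∂j) rewrite ≢true ¬∂j | ∧-zeroʳ (∂ v) =
      trans (ℕ.+-identityʳ _) (count-pair (λ k → nbr d k ∧ g j k)
        (Two-cong (λ {k} → edge-intro k) (λ {k} → edge-elim k) (two-in-g vj λ (_ , ∂j) → ¬∂j ∂j)))

  -- A boundary vertex has two boundary neighbours; by `turn` and properness they carry the two
  -- colours `c` and `d`, one each.
  count-ends : ∀ {c d} → Palette (f v) c d → count (ends c) ≡ 𝟙 (∂ v)
  count-ends {c} {d} (_ , _ , _ , all) with ∂ v in eq
  ... | false = count-none (λ j → nbr c j ∧ false) λ j e → case proj₂ (∧-elim {nbr c j} e) of λ ()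
  ... | true with two (trans (sym (∂≡ v)) eq)
  ... | y , z , y≢z , (xy , vy) , (xz , vz) , only with old (distinct xy) | old (distinct xz)
  ... | i , refl | j , refl = at-one (all (f i) (coloured (to-g vy))) (all (f j) (coloured (to-g vz)))
    where
    coloured : ∀ {k} → g v k ≡ true → f k ≢ f v
    coloured {k} vk e = proper v k (vk , sym e)

    ∂i = trans (∂≡ i) xy
    ∂j = trans (∂≡ j) xz

    fi≢fj : f i ≢ f j
    fi≢fj = turn eq ∂i ∂j (to-g vy) (to-g vz) (y≢z ∘ cong ι)

    candidates : ∀ k → nbr c k ∧ ∂ k ≡ true → (k ≡ i ⊎ k ≡ j) × f k ≡ c
    candidates k e with nbr-elim {c} {k} (proj₁ (∧-elim e))
    ... | vk , fk = Sum.map ι-inj ι-inj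
      (only (ι k) (trans (sym (∂≡ k)) (proj₂ (∧-elim {nbr c k} e)) , from-g vk)) , fk

    at-one : f i ≡ c ⊎ f i ≡ d → f j ≡ c ⊎ f j ≡ d → count (λ k → nbr c k ∧ ∂ k) ≡ 1
    at-one (inj₁ fi) (inj₁ fj) = ⊥-elim (fi≢fj (trans fi (sym fj)))
    at-one (inj₂ fi) (inj₂ fj) = ⊥-elim (fi≢fj (trans fi (sym fj)))
    at-one (inj₁ fi) (inj₂ fj) = count-single (λ k → nbr c k ∧ ∂ k) i (∧-intro (nbr-intro (to-g vy) fi) ∂i) λ k e →
      case candidates k e of λ
        { (inj₁ e , _) → e ; (inj₂ refl , fk) → ⊥-elim (fi≢fj (trans fi (sym fk))) }
    at-one (inj₂ fi) (inj₁ fj) = count-single (λ k → nbr c k ∧ ∂ k) j (∧-intro (nbr-intro (to-g vz) fj) ∂j) λ k e →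
      case candidates k e of λ
        { (inj₂ e , _) → e ; (inj₁ refl , fk) → ⊥-elim (fi≢fj (trans fk (sym fj))) }

  handshake : ∀ {c d} → Palette (f v) c d →
    sum (λ j → count (edges c d j)) + 𝟙 (∂ v) ≡ 2 * count (nbr c)
  handshake {c} {d} P = begin
    sum (λ j → count (edges c d j)) + 𝟙 (∂ v)                    ≡⟨ cong (sum (λ j → count (edges c d j)) +_) (count-ends P) ⟨
    sum (λ j → count (edges c d j)) + count (ends c)             ≡⟨ ∑-distrib-+ (λ j → count (edges c d j)) _ ⟨
    sum (λ j → count (edges c d j) + 𝟙 (ends c j))               ≡⟨ sum-cong-≗ (row P) ⟩
    sum (λ j → 2 * 𝟙 (nbr c j))                                  ≡⟨ *-distribˡ-sum 2 (λ j → 𝟙 (nbr c j)) ⟨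
    2 * count (nbr c)                                            ∎
    where open ≡-Reasoning

  edges-swap : ∀ c d j k → edges c d j k ≡ edges d c k j
  edges-swap c d j k = begin
    nbr c j ∧ (nbr d k ∧ g j k)   ≡⟨ ∧-assoc (nbr c j) (nbr d k) (g j k) ⟨
    (nbr c j ∧ nbr d k) ∧ g j k   ≡⟨ cong₂ _∧_ (∧-comm (nbr c j) (nbr d k)) (trans (g≡ j k) (trans (symm (ι j) (ι k)) (sym (g≡ k j)))) ⟩
    (nbr d k ∧ nbr c j) ∧ g k j   ≡⟨ ∧-assoc (nbr d k) (nbr c j) (g k j) ⟩
    edges d c k j                 ∎
    where open ≡-Reasoning

  even-degree : 2 ∣ degree g v
  even-degree with palette (f v)
  ... | c , d , P@(c≢d , c≢α , d≢α , all) = divides (count (nbr c)) (begin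
      degree g v                                    ≡⟨ length-filterᵇ-tabulate (g v) id ⟩
      count (g v)                                   ≡⟨ sum-cong-≗ split ⟩
      sum (λ j → 𝟙 (nbr c j) + 𝟙 (nbr d j))         ≡⟨ ∑-distrib-+ (λ j → 𝟙 (nbr c j)) _ ⟩
      count (nbr c) + count (nbr d)                 ≡⟨ cong (count (nbr c) +_) balanced ⟨
      count (nbr c) + count (nbr c)                 ≡⟨ cong (count (nbr c) +_) (ℕ.+-identityʳ _) ⟨
      2 * count (nbr c)                             ≡⟨ ℕ.*-comm 2 (count (nbr c)) ⟩
      count (nbr c) * 2                             ∎)
    where
    open ≡-Reasoning

    split : ∀ j → 𝟙 (g v j) ≡ 𝟙 (nbr c j) + 𝟙 (nbr d j)
    split j with g v j in e
    ... | false = refl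
    ... | true with all (f j) (λ e′ → proper v j (e , sym e′))
    ... | inj₁ refl rewrite ==-refl (f j) | ==-≢ c≢d = refl
    ... | inj₂ refl rewrite ==-refl (f j) | ==-≢ (c≢d ∘ sym) = refl

    balanced : count (nbr c) ≡ count (nbr d)
    balanced = ℕ.*-cancelˡ-≡ _ _ 2 (begin
      2 * count (nbr c)                              ≡⟨ handshake P ⟨
      sum (λ j → count (edges c d j)) + 𝟙 (∂ v)      ≡⟨ cong (_+ 𝟙 (∂ v)) (∑-comm (λ j k → 𝟙 (edges c d j k))) ⟩
      sum (λ k → sum λ j → 𝟙 (edges c d j k)) + 𝟙 (∂ v) ≡⟨ cong (_+ 𝟙 (∂ v)) (sum-cong-≗ λ k → sum-cong-≗ λ j → cong 𝟙 (edges-swap c d j k)) ⟩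
      sum (λ k → count (edges d c k)) + 𝟙 (∂ v)      ≡⟨ handshake (Palette-swap P) ⟩
      2 * count (nbr d)                              ∎)

-- The boundary colouring 0, 1, 2, 0, 1, 2, …

rot : Colour → Colour
rot zero             = suc zero
rot (suc zero)       = suc (suc zero)
rot (suc (suc zero)) = zero

rot≢ : ∀ c → rot c ≢ c
rot≢ zero             ()
rot≢ (suc zero)       ()
rot≢ (suc (suc zero)) ()

rot²≢ : ∀ c → rot (rot c) ≢ c
rot²≢ zero             ()
rot²≢ (suc zero)       ()
rot²≢ (suc (suc zero)) ()

periodic : ℕ → Colour
periodic zero    = zero
periodic (suc k) = rot (periodic k)

periodic-multiple : ∀ {k} → 3 ∣ k → periodic k ≡ zero
periodic-multiple (divides zero refl) = refl
periodic-multiple (divides (suc q) refl) rewrite periodic-multiple (divides q refl) = refl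

module _ {n} {g : Adj n} {∂} (B : Ball g ∂) {L} (3∣L : 3 ∣ L) (cycle : IsCycle g (Boundary g) L) where
  open Ball B
  private
    c = proj₁ (proj₂ cycle)
    c-onto = proj₁ (proj₂ (proj₂ (proj₂ (proj₂ cycle))))
    c-adj = proj₂ (proj₂ (proj₂ (proj₂ (proj₂ cycle))))
    c-inj = proj₁ (proj₂ (proj₂ cycle))

    index? : ∀ v → Dec (Σ (Fin L) λ i → c i ≡ v)
    index? v = any? (λ i → c i ≟ v)

    periodic-succ : ∀ {i j : Fin L} → Succ L i j → periodic (toℕ j) ≡ rot (periodic (toℕ i))
    periodic-succ (inj₁ e) = cong periodic (sym e)
    -- The pattern closes up from the last index to index 0 exactly because 3 divides the length.
    periodic-succ (inj₂ (e , z)) =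
      trans (cong periodic z) (sym (trans (cong periodic e) (periodic-multiple 3∣L)))

    colour : ∀ v → Dec (Σ (Fin L) λ i → c i ≡ v) → Colour
    colour v (yes (i , _)) = periodic (toℕ i)
    colour v (no _)        = zero

  boundary-colour : Fin n → Colour
  boundary-colour v = colour v (index? v)

  private
    at : ∀ i → boundary-colour (c i) ≡ periodic (toℕ i)
    at i with index? (c i)
    ... | yes (j , e) = cong (periodic ∘ toℕ) (c-inj e)
    ... | no ne = ⊥-elim (ne (i , refl))

    succ-colour : ∀ {i j} → Succ L i j → boundary-colour (c j) ≡ rot (boundary-colour (c i))
    succ-colour {i} {j} s = trans (at j) (trans (periodic-succ s) (cong rot (sym (at i))))

    position : ∀ {v} → ∂ v ≡ true → Σ (Fin L) λ i → c i ≡ v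
    position ∂v = c-onto _ (∂⇒boundary ∂v)

  boundary-colouring : BoundaryColouring g ∂ boundary-colour
  boundary-colouring = record
    { proper = λ ∂i ∂j → proper (position ∂i) (position ∂j)
    ; turn = λ ∂v ∂i ∂j → turn (position ∂v) (position ∂i) (position ∂j)
    }
    where
    f = boundary-colour

    proper : ∀ {y z} → Σ (Fin L) (λ i → c i ≡ y) → Σ (Fin L) (λ i → c i ≡ z) → g y z ≡ true → f y ≢ f z
    proper (i , refl) (j , refl) ij e with Equivalence.to (c-adj i j) ij
    ... | inj₁ s = rot≢ _ (trans (sym (succ-colour s)) (sym e))
    ... | inj₂ s = rot≢ _ (trans (sym (succ-colour s)) e)

    turn : ∀ {v y z} → Σ (Fin L) (λ i → c i ≡ v) → Σ (Fin L) (λ i → c i ≡ y) → Σ (Fin L) (λ i → c i ≡ z) →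
           g v y ≡ true → g v z ≡ true → y ≢ z → f y ≢ f z
    turn (v , refl) (i , refl) (j , refl) vi vj i≢j e
      with Equivalence.to (c-adj v i) vi | Equivalence.to (c-adj v j) vj
    ... | inj₁ s | inj₁ t = i≢j (cong c (Succ-unique s t))
    ... | inj₂ s | inj₂ t = i≢j (cong c (Pred-unique s t))
    ... | inj₁ s | inj₂ t = rot²≢ _ (trans (cong rot (sym (succ-colour t))) (trans (sym (succ-colour s)) e))
    ... | inj₂ s | inj₁ t = rot²≢ _ (trans (cong rot (sym (succ-colour s))) (trans (sym (succ-colour t)) (sym e)))

  even-refinement : Σ ℕ λ m → Σ (Adj m) λ H → Refines g H × AllEven H
  even-refinement = n′ , g′ , refines , Evenness.even-degree ball coloured proper
    where
    open ProperRefinement (properly-refine (cartesianProduct (allFin n) (allFin n)) B boundary-colouring id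
      λ i j _ → i , j , refl , refl , ∈-cartesianProduct⁺ (∈-allFin i) (∈-allFin j))

-- One-cycles modulo 2 are boundaries

-- The form of finiteness that elimination needs from the index set: deciding whether some vector
-- has a non-zero entry at a given coordinate. It passes to the triples of vertices that index the
-- triangles.
Search : Set → Set₁
Search I = {P : I → Set} → (∀ i → Dec (P i)) → Dec (Σ I P)

search-× : ∀ {I J} → Search I → Search J → Search (I × J)
search-× sI sJ P? = map′ (λ (i , j , p) → (i , j) , p) (λ ((i , j) , p) → i , j , p)
  (sI λ i → sJ λ j → P? (i , j))

xor-interchange : ∀ a b c d → (a xor b) xor (c xor d) ≡ (a xor c) xor (b xor d)
xor-interchange = solve 4 (λ a b c d → (a :+ b) :+ (c :+ d) := (a :+ c) :+ (b :+ d)) refl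
  where open xor-∧-Solver

module _ {A : Set} where

  pair : List A → (A → Bool) → Bool
  pair []      u = false
  pair (a ∷ ℓ) u = u a xor pair ℓ u

  pair-cong : ∀ ℓ {u w : A → Bool} → (∀ a → u a ≡ w a) → pair ℓ u ≡ pair ℓ w
  pair-cong []      e = refl
  pair-cong (a ∷ ℓ) e = cong₂ _xor_ (e a) (pair-cong ℓ e)

  pair-xor : ∀ ℓ (u w : A → Bool) → pair ℓ (λ a → u a xor w a) ≡ pair ℓ u xor pair ℓ w
  pair-xor []      u w = refl
  pair-xor (a ∷ ℓ) u w =
    trans (cong ((u a xor w a) xor_) (pair-xor ℓ u w)) (xor-interchange (u a) (w a) (pair ℓ u) (pair ℓ w))

  pair-∧ : ∀ ℓ b (u : A → Bool) → pair ℓ (λ a → b ∧ u a) ≡ b ∧ pair ℓ u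
  pair-∧ []      b u = sym (∧-zeroʳ b)
  pair-∧ (a ∷ ℓ) b u = trans (cong ((b ∧ u a) xor_) (pair-∧ ℓ b u)) (sym (∧-distribˡ-xor b (u a) (pair ℓ u)))

  pair-sum : ∀ ℓ {n} (u : Fin n → A → Bool) → pair ℓ (λ a → ⊕.sum (λ i → u i a)) ≡ ⊕.sum (λ i → pair ℓ (u i))
  pair-sum []      {n} u = sym (⊕.sum-zero {n} _ λ _ → refl)
  pair-sum (a ∷ ℓ) u = trans (cong (⊕.sum (λ i → u i a) xor_) (pair-sum ℓ u)) (sym (⊕.∑-distrib-+ (λ i → u i a) _))

  combine : ∀ {I : Set} → (I → A → Bool) → List I → A → Bool
  combine v []       a = false
  combine v (i ∷ is) a = v i a xor combine v is a

-- The Fredholm alternative over ℤ/2, by Gaussian elimination; functionals are lists of coordinates.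
module _ {A I : Set} (search : Search I) where

  private
    module Eliminate (a : A) (v : I → A → Bool) (i₀ : I) (pivot : v i₀ a ≡ true) where
      -- The elimination step: projection along the pivot vector onto the functions that vanish at
      -- `a`.
      clear : (A → Bool) → A → Bool
      clear u b = u b xor (u a ∧ v i₀ b)

      clear-a : ∀ u → clear u a ≡ false
      clear-a u = trans (cong (λ b → u a xor (u a ∧ b)) pivot)
        (trans (cong (u a xor_) (∧-identityʳ (u a))) (xor-same (u a)))

      add-pivot : Bool → List I → List I
      add-pivot b is = if b then i₀ ∷ is else is

      combine-add : ∀ c is b → combine v (add-pivot c is) b ≡ (c ∧ v i₀ b) xor combine v is b
      combine-add true  is b = refl
      combine-add false is b = refl

      expand : List I → List I
      expand []       = []
      expand (i ∷ is) = i ∷ add-pivot (v i a) (expand is)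

      combine-expand : ∀ is b → combine v (expand is) b ≡ combine (λ i → clear (v i)) is b
      combine-expand []       b = refl
      combine-expand (i ∷ is) b = begin
        v i b xor combine v (add-pivot (v i a) (expand is)) b      ≡⟨ cong (v i b xor_) (combine-add (v i a) (expand is) b) ⟩
        v i b xor ((v i a ∧ v i₀ b) xor combine v (expand is) b)   ≡⟨ xor-assoc (v i b) _ _ ⟨
        clear (v i) b xor combine v (expand is) b                  ≡⟨ cong (clear (v i) b xor_) (combine-expand is b) ⟩
        combine (λ i → clear (v i)) (i ∷ is) b                     ∎
        where open ≡-Reasoning

      combine-clear-a : ∀ is → combine (λ i → clear (v i)) is a ≡ false
      combine-clear-a []       = refl
      combine-clear-a (i ∷ is) = cong₂ _xor_ (clear-a (v i)) (combine-clear-a is)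

      solution : ∀ ω is b → combine (λ i → clear (v i)) is b ≡ clear ω b →
                 combine v (add-pivot (ω a) (expand is)) b ≡ ω b
      solution ω is b e = begin
        combine v (add-pivot (ω a) (expand is)) b      ≡⟨ combine-add (ω a) (expand is) b ⟩
        (ω a ∧ v i₀ b) xor combine v (expand is) b     ≡⟨ cong ((ω a ∧ v i₀ b) xor_) (trans (combine-expand is b) (trans e (xor-comm (ω b) _))) ⟩
        (ω a ∧ v i₀ b) xor ((ω a ∧ v i₀ b) xor ω b)    ≡⟨ xor-move (ω a ∧ v i₀ b) refl ⟨
        ω b                                            ∎
        where open ≡-Reasoning

      -- The transpose of `clear`: a functional that separates the cleared vectors pulls back to one
      -- that separates the original ones.
      functional : List A → List A
      functional ℓ = if pair ℓ (v i₀) then a ∷ ℓ else ℓ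

      pair-functional : ∀ ℓ u → pair (functional ℓ) u ≡ pair ℓ (clear u)
      pair-functional ℓ u = begin
        pair (functional ℓ) u                           ≡⟨ unfold (pair ℓ (v i₀)) ⟩
        (u a ∧ pair ℓ (v i₀)) xor pair ℓ u              ≡⟨ xor-comm (u a ∧ pair ℓ (v i₀)) _ ⟩
        pair ℓ u xor (u a ∧ pair ℓ (v i₀))              ≡⟨ cong (pair ℓ u xor_) (pair-∧ ℓ (u a) (v i₀)) ⟨
        pair ℓ u xor pair ℓ (λ b → u a ∧ v i₀ b)        ≡⟨ pair-xor ℓ u _ ⟨
        pair ℓ (clear u)                                ∎
        where
        open ≡-Reasoning
        unfold : ∀ c → pair (if c then a ∷ ℓ else ℓ) u ≡ (u a ∧ c) xor pair ℓ u
        unfold true  = cong (_xor pair ℓ u) (sym (∧-identityʳ (u a)))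
        unfold false = cong (_xor pair ℓ u) (sym (∧-zeroʳ (u a)))

  combine-vanishing : ∀ (v : I → A → Bool) a → (∀ i → v i a ≡ false) → ∀ is → combine v is a ≡ false
  combine-vanishing v a z []       = refl
  combine-vanishing v a z (i ∷ is) = cong₂ _xor_ (z i) (combine-vanishing v a z is)

  Alternative : List A → (I → A → Bool) → (A → Bool) → Set
  Alternative as v ω =
    Σ (List I) (λ is → ∀ {b} → b ∈ as → combine v is b ≡ ω b) ⊎
    Σ (List A) (λ ℓ → (∀ i → pair ℓ (v i) ≡ false) × pair ℓ ω ≡ true)

  fredholm : ∀ as v ω → Alternative as v ω
  fredholm [] v ω = inj₁ ([] , λ ())
  fredholm (a ∷ as) v ω with search (λ i → v i a ≟ᵇ true)
  ... | yes (i₀ , pivot) with fredholm as (λ i → Eliminate.clear a v i₀ pivot (v i)) (Eliminate.clear a v i₀ pivot ω)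
  ... | inj₁ (is , sol) = inj₁ (add-pivot (ω a) (expand is) , λ where
      (here refl) → solution ω is a (trans (combine-clear-a is) (sym (clear-a ω)))
      (there b∈)  → solution ω is _ (sol b∈))
    where open Eliminate a v i₀ pivot
  ... | inj₂ (ℓ , zero-on , one) = inj₂ (functional ℓ ,
      (λ i → trans (pair-functional ℓ (v i)) (zero-on i)) , trans (pair-functional ℓ ω) one)
    where open Eliminate a v i₀ pivot
  fredholm (a ∷ as) v ω | no none = without-pivot (ω a) refl
    where
    vanish : ∀ i → v i a ≡ false
    vanish i = ≢true λ e → none (i , e)

    without-pivot : ∀ c → ω a ≡ c → Alternative (a ∷ as) v ω
    -- Evaluation at `a` separates `ω` from the family, as all the `v i` vanish there.
    without-pivot true ωa = inj₂ (a ∷ [] , (λ i → trans (xor-identityʳ _) (vanish i)) , trans (xor-identityʳ _) ωa)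
    without-pivot false ωa = Sum.map₁
      (λ (is , sol) → is , λ where
        (here refl) → trans (combine-vanishing v a vanish is) (sym ωa)
        (there b∈)  → sol b∈)
      (fredholm as v ω)

-- ℤ/2-chains

-- An unoriented edge as a symmetric function on ordered pairs; the `xor` makes it zero for `i`
-- equal to `j`.
edge : ∀ {n} → Fin n → Fin n → Fin n × Fin n → Bool
edge i j (p , q) = ((i == p) ∧ (j == q)) xor ((j == p) ∧ (i == q))

module _ {n} {h : Adj n} (S : Surface h) where
  open Surface S

  triangle : Fin n → Fin n → Fin n → Bool
  triangle i j k = h i j ∧ (h j k ∧ h i k)

  -- Triples that do not span a triangle give the zero chain, so all triples can serve as indices.
  ∂triangle : Fin n × Fin n × Fin n → Fin n × Fin n → Bool
  ∂triangle (i , j , k) a = triangle i j k ∧ (edge j k a xor (edge i k a xor edge i j a))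

  -- τ is the indicator of a set of triangles whose boundary modulo 2 is w.
  record Filling (w : Fin n → Fin n → Bool) : Set where
    field
      τ       : Fin n → Fin n → Fin n → Bool
      sym₁₂   : ∀ p q r → τ p q r ≡ τ q p r
      sym₂₃   : ∀ p q r → τ p q r ≡ τ p r q
      support : ∀ p q r → τ p q r ≡ true → h p q ≡ true × h p r ≡ true × h q r ≡ true
      ∂τ      : ∀ p q → ⊕.sum (τ p q) ≡ w p q

  edge-swap : ∀ i j (p q : Fin n) → edge i j (p , q) ≡ edge i j (q , p)
  edge-swap i j p q = trans (xor-comm _ ((j == p) ∧ (i == q)))
    (cong₂ _xor_ (∧-comm (j == p) (i == q)) (∧-comm (i == p) (j == q)))

  edge-elim : ∀ i j {p q} → h i j ≡ true → edge {n} i j (p , q) ≡ true →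
              (i ≡ p × j ≡ q) ⊎ (j ≡ p × i ≡ q)
  edge-elim i j {p} {q} ij e with (i == p) ∧ (j == q) in eq
  ... | true  = inj₁ (==-sound (proj₁ (∧-elim eq)) , ==-sound (proj₂ (∧-elim {i == p} eq)))
  ... | false = inj₂ (==-sound (proj₁ (∧-elim e)) , ==-sound (proj₂ (∧-elim {j == p} e)))

  sum-indicator : ∀ i b → ⊕.sum {n} (λ r → b ∧ (i == r)) ≡ b
  sum-indicator i b = trans (⊕.sum-single _ i λ j j≢i → trans (cong (b ∧_) (==-≢ (j≢i ∘ sym))) (∧-zeroʳ b))
                            (trans (cong (b ∧_) (==-refl i)) (∧-identityʳ b))

  sum-indicator₂ : ∀ (F : Fin n → Fin n → Bool) p q →
    ⊕.sum (λ i → ⊕.sum λ j → F i j ∧ ((i == p) ∧ (j == q))) ≡ F p q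
  sum-indicator₂ F p q = begin
    ⊕.sum (λ i → ⊕.sum λ j → F i j ∧ ((i == p) ∧ (j == q)))
      ≡⟨ ⊕.sum-single _ p (λ i i≢p → ⊕.sum-zero _ λ j →
           trans (cong (λ b → F i j ∧ (b ∧ (j == q))) (==-≢ i≢p)) (∧-zeroʳ (F i j))) ⟩
    ⊕.sum (λ j → F p j ∧ ((p == p) ∧ (j == q)))
      ≡⟨ ⊕.sum-single _ q (λ j j≢q →
           trans (cong (λ b → F p j ∧ ((p == p) ∧ b)) (==-≢ j≢q)) (trans (cong (F p j ∧_) (∧-zeroʳ (p == p))) (∧-zeroʳ (F p j)))) ⟩
    F p q ∧ ((p == p) ∧ (q == q))
      ≡⟨ cong (F p q ∧_) (cong₂ _∧_ (==-refl p) (==-refl q)) ⟩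
    F p q ∧ true
      ≡⟨ ∧-identityʳ (F p q) ⟩
    F p q ∎
    where open ≡-Reasoning

  xor-elim : ∀ {a b} → a xor b ≡ true → a ≡ true ⊎ b ≡ true
  xor-elim {true}  e = inj₁ refl
  xor-elim {false} e = inj₂ e

  fill-triangle : ∀ t → Filling (λ p q → ∂triangle t (p , q))
  fill-triangle (i , j , k) = record { τ = τ ; sym₁₂ = sym₁₂ ; sym₂₃ = sym₂₃ ; support = support ; ∂τ = ∂τ }
    where
    -- The 3 × 3 permanent of the indicators of i, j, k at p, q, r.
    δ : Fin n → Fin n → Fin n → Bool
    δ p q r = (edge j k (p , q) ∧ (i == r)) xor ((edge i k (p , q) ∧ (j == r)) xor (edge i j (p , q) ∧ (k == r)))

    τ : Fin n → Fin n → Fin n → Bool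
    τ p q r = triangle i j k ∧ δ p q r

    sym₁₂ : ∀ p q r → τ p q r ≡ τ q p r
    sym₁₂ p q r rewrite edge-swap j k p q | edge-swap i k p q | edge-swap i j p q = refl

    sym₂₃ : ∀ p q r → τ p q r ≡ τ p r q
    sym₂₃ p q r = cong (triangle i j k ∧_) (expand (i == p) (i == q) (i == r) (j == p) (j == q) (j == r) (k == p) (k == q) (k == r))
      where
      open xor-∧-Solver
      expand : ∀ ip iq ir jp jq jr kp kq kr →
        (((jp ∧ kq) xor (kp ∧ jq)) ∧ ir) xor ((((ip ∧ kq) xor (kp ∧ iq)) ∧ jr) xor (((ip ∧ jq) xor (jp ∧ iq)) ∧ kr)) ≡
        (((jp ∧ kr) xor (kp ∧ jr)) ∧ iq) xor ((((ip ∧ kr) xor (kp ∧ ir)) ∧ jq) xor (((ip ∧ jr) xor (jp ∧ ir)) ∧ kq))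
      expand = solve 9 (λ ip iq ir jp jq jr kp kq kr →
        (((jp :* kq) :+ (kp :* jq)) :* ir) :+ ((((ip :* kq) :+ (kp :* iq)) :* jr) :+ (((ip :* jq) :+ (jp :* iq)) :* kr)) :=
        (((jp :* kr) :+ (kp :* jr)) :* iq) :+ ((((ip :* kr) :+ (kp :* ir)) :* jq) :+ (((ip :* jr) :+ (jp :* ir)) :* kq))) refl

    support : ∀ p q r → τ p q r ≡ true → h p q ≡ true × h p r ≡ true × h q r ≡ true
    support p q r e with ∧-elim {triangle i j k} e
    ... | t , d with ∧-elim {h i j} t
    ... | ij , t′ with ∧-elim {h j k} t′
    ... | jk , ik with xor-elim d
    ... | inj₁ d₁ with edge-elim j k jk (proj₁ (∧-elim d₁)) | ==-sound {i = i} {r} (proj₂ (∧-elim {edge j k (p , q)} d₁))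
    ... | inj₁ (refl , refl) | refl = jk , flip ij , flip ik
    ... | inj₂ (refl , refl) | refl = flip jk , flip ik , flip ij
    support p q r e | t , d | ij , t′ | jk , ik | inj₂ d′ with xor-elim d′
    ... | inj₁ d₂ with edge-elim i k ik (proj₁ (∧-elim d₂)) | ==-sound {i = j} {r} (proj₂ (∧-elim {edge i k (p , q)} d₂))
    ... | inj₁ (refl , refl) | refl = ik , ij , flip jk
    ... | inj₂ (refl , refl) | refl = flip ik , flip jk , ij
    support p q r e | t , d | ij , t′ | jk , ik | inj₂ d′ | inj₂ d₃
      with edge-elim i j ij (proj₁ (∧-elim d₃)) | ==-sound {i = k} {r} (proj₂ (∧-elim {edge i j (p , q)} d₃))
    ... | inj₁ (refl , refl) | refl = ij , ik , jk
    ... | inj₂ (refl , refl) | refl = flip ij , jk , ik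

    -- `δ` is expanded along the column of `r`, and each indicator in that column sums to 1; what
    -- remains are the 2 × 2 permanents, which are the three edges.
    ∂τ : ∀ p q → ⊕.sum (τ p q) ≡ ∂triangle (i , j , k) (p , q)
    ∂τ p q = begin
      ⊕.sum (λ r → triangle i j k ∧ δ p q r)                ≡⟨ ⊕.*-distribˡ-sum (triangle i j k) (δ p q) ⟨
      triangle i j k ∧ ⊕.sum (δ p q)                        ≡⟨ cong (triangle i j k ∧_) (begin
        ⊕.sum (δ p q)                                       ≡⟨ ⊕.∑-distrib-+ (term i (edge j k (p , q))) _ ⟩
        ⊕.sum (term i (edge j k (p , q))) xor
          ⊕.sum (λ r → term j (edge i k (p , q)) r xor term k (edge i j (p , q)) r)
                                                            ≡⟨ cong₂ _xor_ (sum-indicator i _) (⊕.∑-distrib-+ (term j (edge i k (p , q))) _) ⟩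
        edge j k (p , q) xor
          (⊕.sum (term j (edge i k (p , q))) xor ⊕.sum (term k (edge i j (p , q))))
                                                            ≡⟨ cong (edge j k (p , q) xor_) (cong₂ _xor_ (sum-indicator j _) (sum-indicator k _)) ⟩
        edge j k (p , q) xor (edge i k (p , q) xor edge i j (p , q)) ∎) ⟩
      ∂triangle (i , j , k) (p , q)                         ∎
      where
      open ≡-Reasoning
      term : Fin n → Bool → Fin n → Bool
      term i b r = b ∧ (i == r)

  fill-combination : ∀ ts → Filling (λ p q → combine ∂triangle ts (p , q))
  fill-combination [] = record
    { τ = λ _ _ _ → false ; sym₁₂ = λ _ _ _ → refl ; sym₂₃ = λ _ _ _ → refl ; support = λ _ _ _ ()
    ; ∂τ = λ _ _ → ⊕.sum-zero {n} (λ _ → false) λ _ → refl }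
  fill-combination (t ∷ ts) = record
    { τ = λ p q r → F.τ p q r xor G.τ p q r
    ; sym₁₂ = λ p q r → cong₂ _xor_ (F.sym₁₂ p q r) (G.sym₁₂ p q r)
    ; sym₂₃ = λ p q r → cong₂ _xor_ (F.sym₂₃ p q r) (G.sym₂₃ p q r)
    ; support = λ p q r e → Sum.[ F.support p q r , G.support p q r ] (xor-elim e)
    ; ∂τ = λ p q → trans (⊕.∑-distrib-+ (F.τ p q) (G.τ p q)) (cong₂ _xor_ (F.∂τ p q) (G.∂τ p q))
    }
    where
    module F = Filling (fill-triangle t)
    module G = Filling (fill-combination ts)

  Filling-cong : ∀ {w w′} → (∀ p q → w p q ≡ w′ p q) → Filling w → Filling w′
  Filling-cong e F = record
    { τ = τ ; sym₁₂ = sym₁₂ ; sym₂₃ = sym₂₃ ; support = support ; ∂τ = λ p q → trans (∂τ p q) (e p q) }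
    where open Filling F

  module _ {w : Fin n → Fin n → Bool} (w-sym : ∀ i j → w i j ≡ w j i)
           (w-edge : ∀ i j → w i j ≡ true → h i j ≡ true) (w-cycle : ∀ i → ⊕.sum (w i) ≡ false) where

    -- w with each edge counted in one orientation only, so that w is the sum of its edges.
    w⁺ : Fin n → Fin n → Bool
    w⁺ i j = does (toℕ i ℕ.<? toℕ j) ∧ w i j

    w⁺-both : ∀ i j → w⁺ i j xor w⁺ j i ≡ w i j
    w⁺-both i j with ℕ.<-cmp (toℕ i) (toℕ j)
    ... | tri< lt _ _ = trans
      (cong₂ (λ b c → (b ∧ w i j) xor (c ∧ w j i)) (dec-true (_ ℕ.<? _) lt) (dec-false (_ ℕ.<? _) (ℕ.<-asym lt)))
      (xor-identityʳ (w i j))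
    ... | tri> _ _ gt = trans
      (cong₂ (λ b c → (b ∧ w i j) xor (c ∧ w j i)) (dec-false (_ ℕ.<? _) (ℕ.<-asym gt)) (dec-true (_ ℕ.<? _) gt))
      (w-sym j i)
    ... | tri≈ _ eq _ with toℕ-injective eq
    ... | refl = trans (xor-same (w⁺ i i)) (sym (≢true λ e → irr i (w-edge i i e)))

    w-edges : ∀ p q → ⊕.sum (λ i → ⊕.sum λ j → w⁺ i j ∧ edge i j (p , q)) ≡ w p q
    w-edges p q = begin
      ⊕.sum (λ i → ⊕.sum λ j → w⁺ i j ∧ edge i j (p , q))
        ≡⟨ ⊕.sum-cong-≗ (λ i → trans
             (⊕.sum-cong-≗ λ j → trans
                (∧-distribˡ-xor (w⁺ i j) ((i == p) ∧ (j == q)) _)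
                (cong (λ b → (w⁺ i j ∧ ((i == p) ∧ (j == q))) xor (w⁺ i j ∧ b)) (∧-comm (j == p) (i == q))))
             (⊕.∑-distrib-+ (λ j → w⁺ i j ∧ ((i == p) ∧ (j == q))) _)) ⟩
      ⊕.sum (λ i → ⊕.sum (λ j → w⁺ i j ∧ ((i == p) ∧ (j == q))) xor ⊕.sum (λ j → w⁺ i j ∧ ((i == q) ∧ (j == p))))
        ≡⟨ ⊕.∑-distrib-+ (λ i → ⊕.sum (λ j → w⁺ i j ∧ ((i == p) ∧ (j == q)))) _ ⟩
      ⊕.sum (λ i → ⊕.sum (λ j → w⁺ i j ∧ ((i == p) ∧ (j == q)))) xor
        ⊕.sum (λ i → ⊕.sum (λ j → w⁺ i j ∧ ((i == q) ∧ (j == p))))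
        ≡⟨ cong₂ _xor_ (sum-indicator₂ w⁺ p q) (sum-indicator₂ w⁺ q p) ⟩
      w⁺ p q xor w⁺ q p
        ≡⟨ w⁺-both p q ⟩
      w p q ∎
      where open ≡-Reasoning

    -- Summation by parts: collected by vertices, the coefficient of `f i` is the parity of the
    -- degree of `i` in `w`, which is zero.
    cycle⊥cocycle : ∀ (f : Fin n → Bool) → ⊕.sum (λ i → ⊕.sum λ j → w⁺ i j ∧ (f i xor f j)) ≡ false
    cycle⊥cocycle f = begin
      ⊕.sum (λ i → ⊕.sum λ j → w⁺ i j ∧ (f i xor f j))
        ≡⟨ ⊕.sum-cong-≗ (λ i → trans
             (⊕.sum-cong-≗ λ j → ∧-distribˡ-xor (w⁺ i j) (f i) (f j))
             (⊕.∑-distrib-+ (λ j → w⁺ i j ∧ f i) _)) ⟩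
      ⊕.sum (λ i → ⊕.sum (λ j → w⁺ i j ∧ f i) xor ⊕.sum (λ j → w⁺ i j ∧ f j))
        ≡⟨ ⊕.∑-distrib-+ (λ i → ⊕.sum (λ j → w⁺ i j ∧ f i)) _ ⟩
      ⊕.sum (λ i → ⊕.sum (λ j → w⁺ i j ∧ f i)) xor ⊕.sum (λ i → ⊕.sum (λ j → w⁺ i j ∧ f j))
        ≡⟨ cong (⊕.sum (λ i → ⊕.sum (λ j → w⁺ i j ∧ f i)) xor_) (⊕.∑-comm (λ i j → w⁺ i j ∧ f j)) ⟩
      ⊕.sum (λ i → ⊕.sum (λ j → w⁺ i j ∧ f i)) xor ⊕.sum (λ i → ⊕.sum (λ j → w⁺ j i ∧ f i))
        ≡⟨ ⊕.∑-distrib-+ (λ i → ⊕.sum (λ j → w⁺ i j ∧ f i)) _ ⟨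
      ⊕.sum (λ i → ⊕.sum (λ j → w⁺ i j ∧ f i) xor ⊕.sum (λ j → w⁺ j i ∧ f i))
        ≡⟨ ⊕.sum-zero _ (λ i → begin
             ⊕.sum (λ j → w⁺ i j ∧ f i) xor ⊕.sum (λ j → w⁺ j i ∧ f i)
               ≡⟨ ⊕.∑-distrib-+ (λ j → w⁺ i j ∧ f i) _ ⟨
             ⊕.sum (λ j → (w⁺ i j ∧ f i) xor (w⁺ j i ∧ f i))
               ≡⟨ ⊕.sum-cong-≗ (λ j → trans (sym (∧-distribʳ-xor (f i) (w⁺ i j) (w⁺ j i))) (cong (_∧ f i) (w⁺-both i j))) ⟩
             ⊕.sum (λ j → w i j ∧ f i)
               ≡⟨ ⊕.*-distribʳ-sum (f i) (w i) ⟨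
             ⊕.sum (w i) ∧ f i
               ≡⟨ cong (_∧ f i) (w-cycle i) ⟩
             false ∎) ⟩
      false ∎
      where open ≡-Reasoning

    -- Otherwise some functional `ℓ` kills all triangle boundaries but not `w`. Its values on edges
    -- form a cocycle `φ`, which is the coboundary of some `f`, and a cycle pairs to zero with a
    -- coboundary.
    fill : Filling w
    fill with fredholm (search-× any? (search-× any? any?))
                (cartesianProduct (allFin n) (allFin n)) ∂triangle (λ (p , q) → w p q)
    ... | inj₁ (ts , sol) = Filling-cong
      (λ p q → sol (∈-cartesianProduct⁺ (∈-allFin p) (∈-allFin q))) (fill-combination ts)
    ... | inj₂ (ℓ , vanish , one) = case trans (sym one) pair-w of λ ()
      where
      φ : Fin n → Fin n → Bool
      φ i j = pair ℓ (edge i j)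

      φ-flat : Flat h φ
      φ-flat = (λ i j _ → pair-cong ℓ λ a → xor-comm ((i == proj₁ a) ∧ (j == proj₂ a)) _) ,
        λ i j k ij jk ik → xor-move (φ i j) (trans
          (sym (trans (xor-move (φ j k) (sym (relation i j k ij jk ik))) (xor-identityʳ (φ j k))))
          (xor-comm (φ i k) (φ i j)))
        where
        relation : ∀ i j k → h i j ≡ true → h j k ≡ true → h i k ≡ true →
                   φ j k xor (φ i k xor φ i j) ≡ false
        relation i j k ij jk ik = begin
          φ j k xor (φ i k xor φ i j)
            ≡⟨ cong (φ j k xor_) (pair-xor ℓ (edge i k) (edge i j)) ⟨
          φ j k xor pair ℓ (λ a → edge i k a xor edge i j a)
            ≡⟨ pair-xor ℓ (edge j k) _ ⟨
          pair ℓ (λ a → edge j k a xor (edge i k a xor edge i j a))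
            ≡⟨ cong (_∧ pair ℓ (λ a → edge j k a xor (edge i k a xor edge i j a))) (∧-intro ij (∧-intro jk ik)) ⟨
          triangle i j k ∧ pair ℓ (λ a → edge j k a xor (edge i k a xor edge i j a))
            ≡⟨ pair-∧ ℓ (triangle i j k) _ ⟨
          pair ℓ (∂triangle (i , j , k))
            ≡⟨ vanish (i , j , k) ⟩
          false ∎
          where open ≡-Reasoning

      f = proj₁ (H¹≡0 φ φ-flat)
      f-exact = proj₂ (H¹≡0 φ φ-flat)

      pair-w : pair ℓ (λ (p , q) → w p q) ≡ false
      pair-w = begin
        pair ℓ (λ (p , q) → w p q)
          ≡⟨ pair-cong ℓ (λ (p , q) → sym (w-edges p q)) ⟩
        pair ℓ (λ a → ⊕.sum λ i → ⊕.sum λ j → w⁺ i j ∧ edge i j a)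
          ≡⟨ pair-sum ℓ (λ i a → ⊕.sum λ j → w⁺ i j ∧ edge i j a) ⟩
        ⊕.sum (λ i → pair ℓ λ a → ⊕.sum λ j → w⁺ i j ∧ edge i j a)
          ≡⟨ ⊕.sum-cong-≗ (λ i → trans (pair-sum ℓ (λ j a → w⁺ i j ∧ edge i j a))
               (⊕.sum-cong-≗ λ j → trans (pair-∧ ℓ (w⁺ i j) (edge i j)) (on-w⁺ i j))) ⟩
        ⊕.sum (λ i → ⊕.sum λ j → w⁺ i j ∧ (f i xor f j))
          ≡⟨ cycle⊥cocycle f ⟩
        false ∎
        where
        open ≡-Reasoning
        on-w⁺ : ∀ i j → w⁺ i j ∧ φ i j ≡ w⁺ i j ∧ (f i xor f j)
        on-w⁺ i j with does (toℕ i ℕ.<? toℕ j) | w i j in e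
        ... | false | _     = refl
        ... | true  | false = refl
        ... | true  | true  = f-exact i j (w-edge i j e)

-- Divisibility by 3

∑³ : ∀ {n} → (Fin n → Fin n → Fin n → ℕ) → ℕ
∑³ s = sum λ i → sum λ j → sum λ k → s i j k

-- A triple containing the index `zero` contributes only if it contains it once. By symmetry, each
-- of the three positions of that `zero` contributes the same amount `Q`, and the remaining triples
-- are handled by induction.
∑³-divisible : ∀ {n} (s : Fin n → Fin n → Fin n → ℕ) →
  (∀ i j k → s i j k ≡ s j i k) → (∀ i j k → s i j k ≡ s i k j) → (∀ i k → s i i k ≡ 0) → 3 ∣ ∑³ s
∑³-divisible {zero} s _ _ _ = divides 0 refl
∑³-divisible {suc n} s s₁₂ s₂₃ diag = subst (3 ∣_) (sym split)
  (∣m∣n⇒∣m+n (n∣m*n Q) (∑³-divisible s⁺ (λ i j k → s₁₂ _ _ _) (λ i j k → s₂₃ _ _ _) (λ i k → diag _ _)))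
  where
  open ≡-Reasoning
  s⁺ : Fin n → Fin n → Fin n → ℕ
  s⁺ i j k = s (suc i) (suc j) (suc k)

  Q = sum λ i → sum λ j → s zero (suc i) (suc j)

  first : sum (λ j → sum λ k → s zero j k) ≡ Q
  first = cong₂ _+_ (sum-zero _ (diag zero)) (sum-cong-≗ λ j →
    cong (_+ sum (λ k → s zero (suc j) (suc k))) (trans (s₂₃ zero (suc j) zero) (diag zero (suc j))))

  row : ∀ i → sum (λ j → sum λ k → s (suc i) j k) ≡
        sum (λ j → s zero (suc i) (suc j)) + (sum (λ j → s zero (suc i) (suc j)) + sum (λ j → sum λ k → s⁺ i j k))
  row i = cong₂ _+_
    (cong₂ _+_ (trans (s₁₂ (suc i) zero zero) (trans (s₂₃ zero (suc i) zero) (diag zero (suc i))))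
      (sum-cong-≗ λ j → s₁₂ (suc i) zero (suc j)))
    (trans (sum-cong-≗ λ j → cong (_+ sum (λ k → s⁺ i j k)) (trans (s₂₃ (suc i) (suc j) zero) (s₁₂ (suc i) zero (suc j))))
      (∑-distrib-+ (λ j → s zero (suc i) (suc j)) _))

  split : ∑³ s ≡ Q * 3 + ∑³ s⁺
  split = begin
    sum (λ j → sum λ k → s zero j k) + sum (λ i → sum (λ j → sum λ k → s (suc i) j k))
      ≡⟨ cong₂ _+_ first (trans (sum-cong-≗ row) (trans (∑-distrib-+ (λ i → sum λ j → s zero (suc i) (suc j)) _)
           (cong (Q +_) (∑-distrib-+ (λ i → sum λ j → s zero (suc i) (suc j)) _)))) ⟩
    Q + (Q + (Q + ∑³ s⁺))
      ≡⟨ solve 2 (λ q r → q :+ (q :+ (q :+ r)) := q :* con 3 :+ r) refl Q (∑³ s⁺) ⟩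
    Q * 3 + ∑³ s⁺ ∎
    where open +-*-Solver

-- Colouring the triangles of the sphere by the two sides of the filling

module Deleted {n} {h : Adj n} (S : Surface h) (x : Fin n)
               (even : ∀ v → v ≢ x → ⊕.sum (λ j → h v j ∧ not (j == x)) ≡ false) where
  open Surface S

  -- The edges that avoid `x`, as a chain of the whole sphere. It is a cycle: `even` covers every
  -- other vertex, and no edge of it meets `x`.
  w : Fin n → Fin n → Bool
  w p q = not (p == x) ∧ (h p q ∧ not (q == x))

  w-x : ∀ q → w x q ≡ false
  w-x q rewrite ==-refl x = refl

  w-≢ : ∀ {p} q → p ≢ x → w p q ≡ h p q ∧ not (q == x)
  w-≢ q p≢x rewrite ==-≢ p≢x = refl

  w-sym : ∀ p q → w p q ≡ w q p
  w-sym p q = begin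
    not (p == x) ∧ (h p q ∧ not (q == x))   ≡⟨ ∧-assoc (not (p == x)) (h p q) _ ⟨
    (not (p == x) ∧ h p q) ∧ not (q == x)   ≡⟨ ∧-comm _ (not (q == x)) ⟩
    not (q == x) ∧ (not (p == x) ∧ h p q)   ≡⟨ cong (not (q == x) ∧_) (trans (∧-comm _ (h p q)) (cong (_∧ not (p == x)) (symm p q))) ⟩
    not (q == x) ∧ (h q p ∧ not (p == x))   ∎
    where open ≡-Reasoning

  w-edge : ∀ p q → w p q ≡ true → h p q ≡ true
  w-edge p q e = proj₁ (∧-elim (proj₂ (∧-elim {not (p == x)} e)))

  w-cycle : ∀ p → ⊕.sum (w p) ≡ false
  w-cycle p with p ≟ x
  ... | yes refl = ⊕.sum-zero {n} (λ _ → false) λ _ → refl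
  ... | no p≢x = even p p≢x

  open Filling (fill S w-sym w-edge w-cycle)

  ∂τ-edge : ∀ {p q} → h p q ≡ true → ∀ {u v} → u ≢ v → (∀ z → Common h p q z → z ≡ u ⊎ z ≡ v) →
            τ p q u xor τ p q v ≡ w p q
  ∂τ-edge {p} {q} pq {u} {v} u≢v only = trans (sym (⊕.sum-pair (τ p q) u v u≢v λ k k≢u k≢v →
      ≢true λ e → let (_ , pk , qk) = support p q k e in Sum.[ k≢u , k≢v ] (only k (pk , qk))))
    (∂τ p q)

  -- Edges at `x` are not in the boundary of the filling, so `τ` does not change across them.
  -- Connectedness of the link of `x` then makes `τ` constant on all triangles at `x`.
  around : ∀ {p q r} → h x p ≡ true → Common h x p q → Common h x p r → τ x p q ≡ τ x p r
  around {p} {q} {r} xp cq cr with Two-other (two xp) cq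
  ... | s , q≢s , cs , only with only r cr
  ... | inj₁ refl = refl
  ... | inj₂ refl = sym (trans (xor-move (τ x p q) (sym (trans (∂τ-edge xp q≢s only) (w-x p)))) (xor-identityʳ _))

  along : ∀ {p p′} → Star (Link h x) p p′ → h x p ≡ true →
          ∀ {q q′} → Common h x p q → Common h x p′ q′ → τ x p q ≡ τ x p′ q′
  along ε xp cq cq′ = around xp cq cq′
  along {p} (_◅_ {j = p₁} (_ , xp₁ , pp₁) path) xp cq cq′ =
    trans (around xp cq (xp₁ , pp₁)) (trans (sym₂₃ x p p₁) (along path xp₁ (xp , flip pp₁) cq′))

  constant-at-x : Σ Bool λ c → ∀ p q → h x p ≡ true → Common h x p q → τ x p q ≡ c
  constant-at-x with any? (λ p → h x p ≟ᵇ true)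
  ... | no none = false , λ p q xp _ → ⊥-elim (none (p , xp))
  ... | yes (p₀ , xp₀) with two xp₀
  ... | q₀ , _ , _ , c₀ , _ = τ x p₀ q₀ , λ p q xp c → along (conn x xp xp₀) xp c c₀

  private
    c = proj₁ constant-at-x

  T : Fin n → Fin n → Fin n → Bool
  T p q r = h p q ∧ (h p r ∧ h q r)

  T₁₂ : ∀ p q r → T p q r ≡ T q p r
  T₁₂ p q r = cong₂ _∧_ (symm p q) (∧-comm (h p r) (h q r))

  T₂₃ : ∀ p q r → T p q r ≡ T p r q
  T₂₃ p q r = begin
    h p q ∧ (h p r ∧ h q r)   ≡⟨ ∧-assoc (h p q) _ _ ⟨
    (h p q ∧ h p r) ∧ h q r   ≡⟨ cong₂ _∧_ (∧-comm (h p q) (h p r)) (symm q r) ⟩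
    (h p r ∧ h p q) ∧ h r q   ≡⟨ ∧-assoc (h p r) _ _ ⟩
    h p r ∧ (h p q ∧ h r q)   ∎
    where open ≡-Reasoning

  -- Adding `c` exchanges the two sides if necessary, so that the triangles at `x` are white. After
  -- an exchange `σ` is true on non-triangles too, whence the factor `T` in `black` and `white`.
  σ : Fin n → Fin n → Fin n → Bool
  σ p q r = τ p q r xor c

  black white : Fin n → Fin n → Fin n → ℕ
  black p q r = 𝟙 (T p q r ∧ σ p q r)
  white p q r = 𝟙 (T p q r ∧ not (σ p q r))

  coloured-divisible : ∀ (F : Bool → Bool) → 3 ∣ ∑³ λ p q r → 𝟙 (T p q r ∧ F (σ p q r))
  coloured-divisible F = ∑³-divisible (λ p q r → 𝟙 (T p q r ∧ F (σ p q r)))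
    (λ p q r → cong₂ (λ t b → 𝟙 (t ∧ F (b xor c))) (T₁₂ p q r) (sym₁₂ p q r))
    (λ p q r → cong₂ (λ t b → 𝟙 (t ∧ F (b xor c))) (T₂₃ p q r) (sym₂₃ p q r))
    (λ p r → cong (λ t → 𝟙 ((t ∧ (h p r ∧ h p r)) ∧ F (σ p p r))) (≢true (irr p)))

  σ-x : ∀ {p q} → h x p ≡ true → Common h x p q → σ x p q ≡ false
  σ-x {p} {q} xp cq = trans (cong (_xor c) (proj₂ constant-at-x p q xp cq)) (xor-same c)

  at-x : Fin n → Fin n → ℕ
  at-x p q = 𝟙 (h p q ∧ (p == x))

  edge-sum : ∀ (F : Bool → Bool) {p q} → h p q ≡ true → ((u , v , _) : Two (Common h p q)) →
    sum (λ r → 𝟙 (T p q r ∧ F (σ p q r))) ≡ 𝟙 (F (σ p q u)) + 𝟙 (F (σ p q v))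
  edge-sum F {p} {q} pq (u , v , u≢v , (pu , qu) , (pv , qv) , only) =
    trans (sum-pair (λ r → 𝟙 (T p q r ∧ F (σ p q r))) u v u≢v λ k k≢u k≢v →
             𝟙-false λ e → Sum.[ k≢u , k≢v ] (only k (∧-elim (proj₂ (∧-elim {h p q} (proj₁ (∧-elim e)))))))
          (cong₂ (λ s t → 𝟙 (s ∧ F (σ p q u)) + 𝟙 (t ∧ F (σ p q v)))
             (∧-intro pq (∧-intro pu qu)) (∧-intro pq (∧-intro pv qv)))

  not-edge : ∀ (F : Bool → Bool) {p q} → h p q ≡ false → sum (λ r → 𝟙 (T p q r ∧ F (σ p q r))) ≡ 0
  not-edge F {p} {q} pq = sum-zero _ λ r → cong (λ b → 𝟙 ((b ∧ (h p r ∧ h q r)) ∧ F (σ p q r))) pq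

  -- The two triangles on an edge have different colours, except that both are white if the edge contains x.
  excess : ∀ p q → sum (white p q) ≡ sum (black p q) + 2 * (at-x p q + at-x q p)
  excess p q = by-edge (h p q ≟ᵇ true)
    where
    by-edge : Dec (h p q ≡ true) → sum (white p q) ≡ sum (black p q) + 2 * (at-x p q + at-x q p)
    by-edge (no pq) = begin
      sum (white p q)                                   ≡⟨ not-edge not (≢true pq) ⟩
      0 + 2 * (0 + 0)                                   ≡⟨ cong₂ _+_ (not-edge id (≢true pq)) (cong₂ (λ a b → 2 * (𝟙 (a ∧ (p == x)) + 𝟙 (b ∧ (q == x)))) (≢true pq) (trans (symm q p) (≢true pq))) ⟨
      sum (black p q) + 2 * (at-x p q + at-x q p)       ∎
      where open ≡-Reasoning
    by-edge (yes pq) with two pq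
    ... | t@(u , v , u≢v , cu@(pu , qu) , cv@(pv , qv) , only) = begin
      sum (white p q)                                   ≡⟨ edge-sum not pq t ⟩
      𝟙 (not (σ p q u)) + 𝟙 (not (σ p q v))             ≡⟨ by-x (p ≟ x) (q ≟ x) ⟩
      𝟙 (σ p q u) + 𝟙 (σ p q v) + 2 * (𝟙 (p == x) + 𝟙 (q == x))
        ≡⟨ cong₂ _+_ (edge-sum id pq t) (cong₂ (λ a b → 2 * (𝟙 (a ∧ (p == x)) + 𝟙 (b ∧ (q == x)))) pq (flip pq)) ⟨
      sum (black p q) + 2 * (at-x p q + at-x q p)       ∎
      where
      open ≡-Reasoning

      both-white : ∀ {m} → σ p q u ≡ false → σ p q v ≡ false → m ≡ 1 →
        𝟙 (not (σ p q u)) + 𝟙 (not (σ p q v)) ≡ 𝟙 (σ p q u) + 𝟙 (σ p q v) + 2 * m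
      both-white su sv e rewrite su | sv | e = refl

      opposite : ∀ a b k → a xor b ≡ true → 𝟙 (not (a xor k)) + 𝟙 (not (b xor k)) ≡ 𝟙 (a xor k) + 𝟙 (b xor k) + 0
      opposite true  false true  _ = refl
      opposite true  false false _ = refl
      opposite false true  true  _ = refl
      opposite false true  false _ = refl

      by-x : Dec (p ≡ x) → Dec (q ≡ x) →
        𝟙 (not (σ p q u)) + 𝟙 (not (σ p q v)) ≡ 𝟙 (σ p q u) + 𝟙 (σ p q v) + 2 * (𝟙 (p == x) + 𝟙 (q == x))
      by-x (yes refl) _ = both-white (σ-x pq cu) (σ-x pq cv)
        (cong₂ (λ a b → 𝟙 a + 𝟙 b) (==-refl x) (==-≢ (distinct pq ∘ sym)))
      by-x (no p≢x) (yes refl) = both-white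
        (trans (cong (_xor c) (sym₁₂ p x u)) (σ-x (flip pq) (qu , pu)))
        (trans (cong (_xor c) (sym₁₂ p x v)) (σ-x (flip pq) (qv , pv)))
        (cong₂ (λ a b → 𝟙 a + 𝟙 b) (==-≢ p≢x) (==-refl x))
      by-x (no p≢x) (no q≢x) = trans
        (opposite (τ p q u) (τ p q v) c (trans (∂τ-edge pq u≢v only)
          (trans (w-≢ q p≢x) (∧-intro pq (cong not (==-≢ q≢x))))))
        (cong₂ (λ a b → 𝟙 (σ p q u) + 𝟙 (σ p q v) + 2 * (𝟙 a + 𝟙 b)) (sym (==-≢ p≢x)) (sym (==-≢ q≢x)))

  sum-at-x : sum (λ p → sum λ q → at-x p q) ≡ count (h x)
  sum-at-x = trans
    (sum-single _ x λ p p≢x → sum-zero _ λ q → cong 𝟙 (trans (cong (h p q ∧_) (==-≢ p≢x)) (∧-zeroʳ (h p q))))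
    (sum-cong-≗ λ q → cong 𝟙 (trans (cong (h x q ∧_) (==-refl x)) (∧-identityʳ (h x q))))

  3∣degree : 3 ∣ count (h x)
  3∣degree = ∣m+n∣m⇒∣n (subst (3 ∣_) rearrange (∣m+n∣m⇒∣n (subst (3 ∣_) total (coloured-divisible not)) (coloured-divisible id)))
                       (n∣m*n (count (h x)))
    where
    open ≡-Reasoning
    d = count (h x)

    -- Each of the `d` edges at `x` occurs in two orders, and each order contributes two white
    -- triangles that no black ones balance.
    total : ∑³ white ≡ ∑³ black + 2 * (d + d)
    total = begin
      sum (λ p → sum λ q → sum (white p q))
        ≡⟨ sum-cong-≗ (λ p → trans (sum-cong-≗ (excess p)) (∑-distrib-+ (λ q → sum (black p q)) _)) ⟩
      sum (λ p → sum (λ q → sum (black p q)) + sum (λ q → 2 * (at-x p q + at-x q p)))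
        ≡⟨ ∑-distrib-+ (λ p → sum λ q → sum (black p q)) _ ⟩
      ∑³ black + sum (λ p → sum λ q → 2 * (at-x p q + at-x q p))
        ≡⟨ cong (∑³ black +_) (trans (sum-cong-≗ λ p → sym (*-distribˡ-sum 2 (λ q → at-x p q + at-x q p)))
             (sym (*-distribˡ-sum 2 (λ p → sum λ q → at-x p q + at-x q p)))) ⟩
      ∑³ black + 2 * sum (λ p → sum λ q → at-x p q + at-x q p)
        ≡⟨ cong (λ m → ∑³ black + 2 * m) (trans (sum-cong-≗ λ p → ∑-distrib-+ (at-x p) _)
             (∑-distrib-+ (λ p → sum (at-x p)) _)) ⟩
      ∑³ black + 2 * (sum (λ p → sum λ q → at-x p q) + sum (λ p → sum λ q → at-x q p))
        ≡⟨ cong (λ m → ∑³ black + 2 * m) (cong₂ _+_ sum-at-x (trans (∑-comm (λ p q → at-x q p)) sum-at-x)) ⟩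
      ∑³ black + 2 * (d + d) ∎

    rearrange : 2 * (d + d) ≡ d * 3 + d
    rearrange = solve 1 (λ d → con 2 :* (d :+ d) := d :* con 3 :+ d) refl d
      where open +-*-Solver

-- The length of the boundary and the theorem

ball-degree : ∀ {n} {g : Adj n} {∂} (B : Ball g ∂) → count (Ball.h B (Ball.x B)) ≡ count ∂
ball-degree B = trans (sum-remove {i = x} (λ i → 𝟙 (h x i))) (cong₂ _+_ (𝟙-false (irr x))
  (sum-cong-≗ λ i → cong 𝟙 (sym (∂≡ i))))
  where open Ball B

even⇒3∣∂ : ∀ {n} {g : Adj n} {∂} → Ball g ∂ → AllEven g → 3 ∣ count ∂
even⇒3∣∂ {n} {g} B all-even = subst (3 ∣_) (ball-degree B) (Deleted.3∣degree surface x even)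
  where
  open Ball B

  at-old : ∀ i → ⊕.sum (λ j → h (ι i) j ∧ not (j == x)) ≡ false
  at-old i = begin
    ⊕.sum (λ j → h (ι i) j ∧ not (j == x))
      ≡⟨ ⊕.sum-remove {i = x} (λ j → h (ι i) j ∧ not (j == x)) ⟩
    (h (ι i) x ∧ not (x == x)) xor ⊕.sum (λ j → h (ι i) (ι j) ∧ not (ι j == x))
      ≡⟨ cong₂ _xor_ (trans (cong (λ b → h (ι i) x ∧ not b) (==-refl x)) (∧-zeroʳ (h (ι i) x)))
           (⊕.sum-cong-≗ λ j → trans (cong₂ (λ a b → a ∧ not b) (sym (g≡ i j)) (==-≢ (x≢ι ∘ sym))) (∧-identityʳ (g i j))) ⟩
    ⊕.sum (g i)
      ≡⟨ ⊕-parity (g i) ⟩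
    odd (count (g i))
      ≡⟨ cong odd (length-filterᵇ-tabulate (g i) id) ⟨
    odd (degree g i)
      ≡⟨ even⇒odd≡false (all-even i) ⟩
    false ∎
    where open ≡-Reasoning

  even : ∀ v → v ≢ x → ⊕.sum (λ j → h v j ∧ not (j == x)) ≡ false
  even v v≢x with old (v≢x ∘ sym)
  ... | i , refl = at-old i

-- Each step prepends `false` to `∂`, which leaves the count unchanged by computation.
refined-ball : ∀ {n m} {g : Adj n} {H : Adj m} {∂} → Ball g ∂ → Refines g H →
  Σ (Fin m → Bool) λ ∂′ → Ball H ∂′ × count ∂′ ≡ count ∂
refined-ball B (done _) = _ , B , refl
refined-ball {g = g} B (step _ _ a b ab interior steps) =
  refined-ball (refine-ball B ab λ (∂a , ∂b) → interior (Ball.∂⇒boundary B ∂a , Ball.∂⇒boundary B ∂b)) steps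

-- Double counting of the pairs of `v` and `i` with `c i ≡ v`: one for each `v` satisfying `p`, and
-- one for each `i`.
count-image : ∀ {n} (p : Fin n → Bool) {L} (c : Fin L → Fin n) → (∀ {i j} → c i ≡ c j → i ≡ j) →
  (∀ i → p (c i) ≡ true) → (∀ v → p v ≡ true → Σ (Fin L) λ i → c i ≡ v) → count p ≡ L
count-image {n} p {L} c c-inj c-mem c-onto = begin
  sum (λ v → 𝟙 (p v))                        ≡⟨ sum-cong-≗ fibre ⟩
  sum (λ v → count (λ i → c i == v))         ≡⟨ ∑-comm (λ v i → 𝟙 (c i == v)) ⟩
  sum (λ i → count (λ v → c i == v))         ≡⟨ sum-cong-≗ (λ i → count-single (c i ==_) (c i) (==-refl (c i)) λ v e → sym (==-sound e)) ⟩
  sum {L} (λ _ → 1)                          ≡⟨ sum-ones L ⟩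
  L                                          ∎
  where
  open ≡-Reasoning

  sum-ones : ∀ L → sum {L} (λ _ → 1) ≡ L
  sum-ones zero    = refl
  sum-ones (suc L) = cong suc (sum-ones L)

  fibre : ∀ v → 𝟙 (p v) ≡ count (λ i → c i == v)
  fibre v with p v in e
  ... | true with c-onto v e
  ... | i , refl = sym (count-single (λ j → c j == c i) i (==-refl (c i)) λ j e → c-inj (==-sound e))
  fibre v | false = sym (count-none (λ i → c i == v) λ i e′ →
    case trans (sym e) (trans (cong p (sym (==-sound e′))) (c-mem i)) of λ ())

boundary-length : ∀ {n} {g : Adj n} {∂} → Ball g ∂ → ∀ {L} → IsCycle g (Boundary g) L → count ∂ ≡ L
boundary-length B (_ , c , c-inj , c-mem , c-onto , _) =
  count-image _ c c-inj (boundary⇒∂ ∘ c-mem) (λ v → c-onto v ∘ ∂⇒boundary)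
  where open Ball B

twoBall-ball : ∀ {n} {g : Adj n} → TwoBall g → Σ (Fin n → Bool) (Ball g)
twoBall-ball (_ , h , x , sphere , g≡h) = (λ i → h x (punchIn x i)) , record
  { h = h ; x = x ; surface = sphere-surface sphere ; g≡ = g≡h ; ∂≡ = λ _ → refl }

mainTheorem2 : (n : ℕ) (G : Adj n) → TwoBall G →
    (L : ℕ) → IsCycle G (Boundary G) L →
    (Σ ℕ λ m → Σ (Adj m) λ H → Refines G H × AllEven H) ⇔ (3 ∣ L)
mainTheorem2 n G ball L cycle with twoBall-ball ball
... | ∂ , B = mk⇔ forward λ 3∣L → even-refinement B 3∣L cycle
  where
  forward : (Σ ℕ λ m → Σ (Adj m) λ H → Refines G H × AllEven H) → 3 ∣ L
  forward (m , H , steps , all-even) with refined-ball B steps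
  ... | ∂′ , B′ , same = subst (3 ∣_) (trans same (boundary-length B cycle)) (even⇒3∣∂ B′ all-even)
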